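{- Let $r\geq 3$, $s\geq 1$ and $n>3r^2s$ be integers. Let $\mathcal{H}_1,\dots,\mathcal{H}_s$ be properly edge-colored $r$-uniform hypergraphs on a common vertex set of $n$ vertices such that $\sigma_r(\mathcal{H}_i)>r\left(\binom{n-1}{r-1}-\binom{n-s}{r-1}\right)$ for every $i$. Then there exists an $s$-rainbow matching in $\mathcal{H}_1,\dots,\mathcal{H}_s$.
   Context: An $r$-uniform hypergraph on an $n$-element vertex set $V$ is a family of $r$-subsets of $V$ (its edges). The degree $\deg(v)$ is the number of edges containing $v$; for an $r$-set $S$, $\deg(S)=\sum_{v\in S}\deg(v)$. The Ore-degree $\sigma_r(\mathcal{H})$ is the minimum of $\deg(S)$ over all $r$-subsets $S\subseteq V$ that are not edges of $\mathcal{H}$. A hypergraph whose edges are assigned colors is properly edge-colored if no two edges sharing a vertex receive the same color. An $s$-rainbow matching in properly edge-colored hypergraphs $\mathcal{H}_1,\dots,\mathcal{H}_s$ is a collection of pairwise disjoint edges $e_1,\dots,e_s$ with $e_i\in\mathcal{H}_i$ for each $i$, all having distinct colors. -}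

module Defs where

open import Data.Nat using (ℕ; zero; suc; _+_; _*_; _∸_; _<_)
open import Data.Nat.Combinatorics using (_C_)
open import Data.Bool using (Bool; true; false; T; _∧_)
open import Data.Fin using (Fin)
open import Data.Fin.Subset using (Subset; inside; outside; _∈_; _∩_; ∣_∣; Empty)
open import Data.Fin.Subset.Properties using (_∈?_)
open import Data.List using (List; []; _∷_; _++_; map; filterᵇ; length; allFin)
open import Data.Nat.ListAction using (sum)
open import Data.Product using (Σ; _×_)
open import Data.Vec using (Vec; []; _∷_)
open import Relation.Nullary using (¬_; does)
open import Relation.Binary.PropositionalEquality using (_≡_)

allSubsets : (n : ℕ) → List (Subset n)
allSubsets zero = [] ∷ []
allSubsets (suc n) = map (inside ∷_) (allSubsets n) ++ map (outside ∷_) (allSubsets n)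

record Hypergraph (n r : ℕ) : Set where
  field
    isEdge  : Subset n → Bool
    uniform : ∀ (e : Subset n) → T (isEdge e) → ∣ e ∣ ≡ r
open Hypergraph public

Edge : ∀ {n r} → Hypergraph n r → Subset n → Set
Edge H e = T (isEdge H e)

degree : ∀ {n r} → Hypergraph n r → Fin n → ℕ
degree {n} H v = length (filterᵇ (λ e → isEdge H e ∧ does (v ∈? e)) (allSubsets n))

degSet : ∀ {n r} → Hypergraph n r → Subset n → ℕ
degSet {n} H S = sum (map (degree H) (filterᵇ (λ v → does (v ∈? S)) (allFin n)))

-- σ_r(H) > b, i.e. every r-subset that is not an edge has deg(S) > b
-- (vacuous when there is no such S, matching min ∅ = ∞)
OreDegreeGreaterThan : ∀ {n r} → Hypergraph n r → ℕ → Set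
OreDegreeGreaterThan {n} {r} H b =
  ∀ (S : Subset n) → ∣ S ∣ ≡ r → ¬ Edge H S → b < degSet H S

Disjoint : ∀ {n} → Subset n → Subset n → Set
Disjoint e f = Empty (e ∩ f)

ProperColoring : ∀ {n r} → Hypergraph n r → (Subset n → ℕ) → Set
ProperColoring {n} H c =
  ∀ (e f : Subset n) → Edge H e → Edge H f → ¬ e ≡ f → ¬ Disjoint e f → ¬ c e ≡ c f

RainbowMatching : ∀ {n r s} → (Fin s → Hypergraph n r) → (Fin s → Subset n → ℕ) → Set
RainbowMatching {n} {r} {s} H c =
  Σ (Fin s → Subset n) λ e →
      (∀ i → Edge (H i) (e i))
    × (∀ i j → ¬ i ≡ j → Disjoint (e i) (e j))
    × (∀ i j → ¬ i ≡ j → ¬ c i (e i) ≡ c j (e j))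

oreBound : ℕ → ℕ → ℕ → ℕ
oreBound n r s = r * (((n ∸ 1) C (r ∸ 1)) ∸ ((n ∸ s) C (r ∸ 1)))

{-# OPTIONS --safe #-}
-- Following Huang, Loh and Sudakov, induct on s, writing s + 1 for the number of hypergraphs, a for the maximal possible
-- codegree of two vertices, and t = s (2a + 1).
-- * If a vertex v has degree more than s (r a + 1) in some Hᵢ, delete v from the other hypergraphs; a rainbow matching
--   of those extends by an edge of Hᵢ through v.
-- * If every Hᵢ has more than s vertices of degree more than t, choose distinct such vertices vᵢ ∈ Hᵢ. In the links of the
--   vᵢ proper colourings become injective, so that a rainbow matching of the links follows from the analogous theorem for
--   families with many edges and injective colourings, which is proved by the same case distinction, lowering the uniformity.
-- * Otherwise some Hᵢ has at most s vertices of degree more than t. Take a rainbow matching of the others, covering the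
--   set W, and suppose that no edge of Hᵢ extends it. Then a vertex u outside W has degree at most
--   s + Σ_{w ∈ W} codeg(u, w), while the Ore condition forces all but r + s - 1 of these u to have degree more than
--   C(n-1, r-1) - C(n-s-1, r-1). Summing over u contradicts n > 3 r² (s + 1).
module Submission where

open import Defs
open import Data.Bool using (T; true; false; _∧_)
import Data.Bool as Bool
open import Data.Bool.Properties using (T?; T-∧)
open import Data.Empty using (⊥)
open import Data.Fin using (Fin; zero; suc; punchIn; punchOut; _≟_)
open import Data.Fin.Properties using (punchIn-punchOut; any?; all?)
open import Data.Fin.Subset using (Subset; inside; outside; ∣_∣; _-_; _∩_; _∪_; ⁅_⁆; ⊤; _⊆_) renaming (⊥ to ∅; _∈_ to _∈ˢ_; _∉_ to _∉ˢ_)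
open import Data.Fin.Subset.Properties using (_∈?_; drop-there; drop-∷-⊆; p─⊥≡p; p─q⊆p; x∈p∧x≢y⇒x∈p-y; ⊆-antisym; x∈p∩q⁺; x∈p∩q⁻; nonempty?; ∣⊤∣≡n; ∈⊤; ∉⊥; x∈⁅x⁆; x∈⁅y⁆⇒x≡y; x∈p∪q⁺; x∈p∪q⁻)
open import Data.List using (List; []; _∷_; _++_; map; filter; length; concat; tabulate; allFin; take)
open import Data.List.Membership.Propositional using (_∈_; _∉_; find; lose)
open import Data.List.Membership.Propositional.Properties using (∈-filter⁺; ∈-filter⁻; ∈-map⁺; ∈-map⁻; ∈-tabulate⁺; ∈-allFin; ∈-++⁺ˡ; ∈-++⁺ʳ; ∈-concat⁺′)
open import Data.List.Properties using (length-map; length-++; length-filter; length-tabulate; length-take; length-removeAt′; filter-some; filter-≐; map-∘; map-tabulate; map-cong)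
open import Data.List.Relation.Unary.All using (All; []; _∷_)
import Data.List.Relation.Unary.All as All
import Data.List.Relation.Unary.All.Properties as All
open import Data.List.Relation.Unary.AllPairs using ([]; _∷_)
import Data.List.Relation.Unary.AllPairs.Properties as AllPairs
open import Data.List.Relation.Unary.Any using (Any; here; there; _─_; index)
import Data.List.Relation.Unary.Any as Any
open import Data.List.Relation.Unary.Unique.Propositional using (Unique)
import Data.List.Relation.Unary.Unique.Propositional.Properties as Unique
open import Data.Nat hiding (_≟_; ∣_-_∣)
open import Data.Nat.Combinatorics using (_C_; nCk+nC[k+1]≡[n+1]C[k+1]; nC1≡n; nCn≡1; k>n⇒nCk≡0)
open import Data.Nat.ListAction using (sum)
open import Data.Nat.Properties renaming (_≟_ to _≟ℕ_)
open import Algebra.Properties.CommutativeSemigroup +-commutativeSemigroup using (interchange; x∙yz≈y∙xz)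
open import Data.Nat.Tactic.RingSolver using (solve-∀)
open import Data.Product using (Σ-syntax; ∃-syntax; _×_; _,_; proj₁; proj₂; map₁)
open import Data.Sum using (inj₁; inj₂)
open import Data.Unit using (tt)
open import Data.Vec using ([]; _∷_; here; there)
open import Data.Vec.Functional using (removeAt; insertAt)
open import Data.Vec.Functional.Properties using (insertAt-lookup; insertAt-punchIn)
open import Data.Vec.Properties using (≡-dec)
open import Function using (_∘_; id; Equivalence)
open import Relation.Binary.Definitions using (DecidableEquality)
open import Relation.Binary.PropositionalEquality
open import Relation.Nullary using (¬_; Dec; yes; no; does; contradiction; ¬?)
open import Relation.Nullary.Decidable using (_×-dec_; decidable-stable)
open import Relation.Unary using (Decidable)

private variable
  n s k m : ℕ

-- Counting in lists

∈-─⁺ : {A : Set} {x y : A} {ys : List A} (p : x ∈ ys) → y ∈ ys → x ≢ y → y ∈ (ys ─ p)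
∈-─⁺ (here refl) (here refl) x≢y = contradiction refl x≢y
∈-─⁺ (here refl) (there q)   x≢y = q
∈-─⁺ (there p)   (here refl) x≢y = here refl
∈-─⁺ (there p)   (there q)   x≢y = there (∈-─⁺ p q x≢y)

-- Pigeonhole principle behind nearly every cardinality bound below. The head of `xs` is struck from
-- `ys`, and uniqueness keeps the tail inside what remains.
Unique⊆⇒length≤ : {A : Set} {xs ys : List A} → Unique xs → (∀ {x} → x ∈ xs → x ∈ ys) → length xs ≤ length ys
Unique⊆⇒length≤ []            xs⊆ys = z≤n
Unique⊆⇒length≤ {ys = ys} (x∉xs ∷ u) xs⊆ys = begin
  suc _                  ≤⟨ s≤s (Unique⊆⇒length≤ u (λ y∈xs → ∈-─⁺ p (xs⊆ys (there y∈xs)) (All.lookup x∉xs y∈xs))) ⟩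
  suc (length (ys ─ p))  ≡⟨ length-removeAt′ ys (index p) ⟨
  length ys              ∎
  where
  open ≤-Reasoning
  p = xs⊆ys (here refl)

module _ {A : Set} (_≟ᴬ_ : DecidableEquality A) where
  open import Data.List.Membership.DecPropositional _≟ᴬ_ using () renaming (_∈?_ to _∈ᴸ?_)

  Unique⇒∃∉ : {xs ys : List A} → Unique xs → length ys < length xs → ∃[ x ] (x ∈ xs × x ∉ ys)
  Unique⇒∃∉ {xs} {ys} u ys<xs with Any.any? (λ x → ¬? (x ∈ᴸ? ys)) xs
  ... | yes p = find p
  ... | no ¬p = contradiction (Unique⊆⇒length≤ u xs⊆ys) (<⇒≱ ys<xs)
    where
    xs⊆ys : ∀ {x} → x ∈ xs → x ∈ ys
    xs⊆ys {x} x∈xs = decidable-stable (x ∈ᴸ? ys) (λ x∉ys → ¬p (lose x∈xs x∉ys))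

  -- Greedy choice: the later indices are served first, and the list at `zero` is longer than the
  -- list of elements used so far.
  distinctRepresentatives : ∀ {s} (B : Fin s → List A) → (∀ i → Unique (B i)) → (∀ i → s ≤ length (B i)) →
    Σ[ v ∈ (Fin s → A) ] (∀ i → v i ∈ B i) × (∀ {i j} → v i ≡ v j → i ≡ j)
  distinctRepresentatives {zero}  B uniq large = (λ ()) , (λ ()) , λ {i} → contradiction i λ ()
  distinctRepresentatives {suc s} B uniq large
    with distinctRepresentatives (B ∘ suc) (uniq ∘ suc) (λ i → <⇒≤ (large (suc i)))
  ... | v , v∈B , v-inj
    with Unique⇒∃∉ {ys = tabulate v} (uniq zero) (≤-trans (s≤s (≤-reflexive (length-tabulate v))) (large zero))
  ... | x , x∈B , x∉v = w , w∈B , w-inj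
    where
    w : Fin (suc s) → A
    w zero    = x
    w (suc i) = v i

    w∈B : ∀ i → w i ∈ B i
    w∈B zero    = x∈B
    w∈B (suc i) = v∈B i

    w-inj : ∀ {i j} → w i ≡ w j → i ≡ j
    w-inj {zero}  {zero}  eq = refl
    w-inj {zero}  {suc j} eq = contradiction (subst (_∈ tabulate v) (sym eq) (∈-tabulate⁺ j)) x∉v
    w-inj {suc i} {zero}  eq = contradiction (subst (_∈ tabulate v) eq (∈-tabulate⁺ i)) x∉v
    w-inj {suc i} {suc j} eq = cong suc (v-inj eq)

module _ {A : Set} {P : A → Set} (P? : Decidable P) where

  length-filter-cons : ∀ x xs → length (filter P? (x ∷ xs)) ≡ length (filter P? (x ∷ [])) + length (filter P? xs)
  length-filter-cons x xs with P? x
  ... | yes _ = refl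
  ... | no  _ = refl

  length-filter-split : ∀ xs → length xs ≡ length (filter P? xs) + length (filter (¬? ∘ P?) xs)
  length-filter-split []       = refl
  length-filter-split (x ∷ xs) with P? x
  ... | yes _ = cong suc (length-filter-split xs)
  ... | no  _ = trans (cong suc (length-filter-split xs)) (sym (+-suc _ _))

  length-filter-map : {B : Set} (f : B → A) → ∀ xs → length (filter P? (map f xs)) ≡ length (filter (P? ∘ f) xs)
  length-filter-map f []       = refl
  length-filter-map f (x ∷ xs) with P? (f x)
  ... | yes _ = cong suc (length-filter-map f xs)
  ... | no  _ = length-filter-map f xs

  length-filter-filter : {Q : A → Set} (Q? : Decidable Q) → ∀ xs →
    length (filter P? (filter Q? xs)) ≡ length (filter (λ x → P? x ×-dec Q? x) xs)
  length-filter-filter Q? []       = refl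
  length-filter-filter Q? (x ∷ xs) with Q? x | P? x in eq
  ... | no  _ | yes _ = length-filter-filter Q? xs
  ... | no  _ | no  _ = length-filter-filter Q? xs
  ... | yes _ | yes _ rewrite eq = cong suc (length-filter-filter Q? xs)
  ... | yes _ | no  _ rewrite eq = length-filter-filter Q? xs

length-filter-mono : {A : Set} {P Q : A → Set} (P? : Decidable P) (Q? : Decidable Q) →
  (∀ {x} → P x → Q x) → ∀ xs → length (filter P? xs) ≤ length (filter Q? xs)
length-filter-mono P? Q? P⇒Q [] = z≤n
length-filter-mono P? Q? P⇒Q (x ∷ xs) with P? x | Q? x
... | yes p | yes q = s≤s (length-filter-mono P? Q? P⇒Q xs)
... | yes p | no ¬q = contradiction (P⇒Q p) ¬q
... | no ¬p | yes q = m≤n⇒m≤1+n (length-filter-mono P? Q? P⇒Q xs)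
... | no ¬p | no ¬q = length-filter-mono P? Q? P⇒Q xs

sum-map-mono : {A : Set} {f g : A → ℕ} (xs : List A) → (∀ {x} → x ∈ xs → f x ≤ g x) → sum (map f xs) ≤ sum (map g xs)
sum-map-mono []       f≤g = z≤n
sum-map-mono (x ∷ xs) f≤g = +-mono-≤ (f≤g (here refl)) (sum-map-mono xs (f≤g ∘ there))

sum-map-const : {A : Set} (b : ℕ) (xs : List A) → sum (map (λ _ → b) xs) ≡ length xs * b
sum-map-const b []       = refl
sum-map-const b (x ∷ xs) = cong (b +_) (sum-map-const b xs)

sum-map≤length* : {A : Set} {f : A → ℕ} {b : ℕ} (xs : List A) → (∀ {x} → x ∈ xs → f x ≤ b) → sum (map f xs) ≤ length xs * b
sum-map≤length* {b = b} xs f≤b = ≤-trans (sum-map-mono xs f≤b) (≤-reflexive (sum-map-const b xs))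

sum-map-+ : {A : Set} (f g : A → ℕ) (xs : List A) → sum (map (λ x → f x + g x) xs) ≡ sum (map f xs) + sum (map g xs)
sum-map-+ f g []       = refl
sum-map-+ f g (x ∷ xs) = begin
  f x + g x + sum (map (λ x → f x + g x) xs)         ≡⟨ cong (f x + g x +_) (sum-map-+ f g xs) ⟩
  f x + g x + (sum (map f xs) + sum (map g xs))      ≡⟨ interchange (f x) (g x) _ _ ⟩
  f x + sum (map f xs) + (g x + sum (map g xs))      ∎
  where open ≡-Reasoning

sum-map-* : {A : Set} (b : ℕ) (f : A → ℕ) (xs : List A) → sum (map (λ x → b * f x) xs) ≡ b * sum (map f xs)
sum-map-* b f []       = sym (*-zeroʳ b)
sum-map-* b f (x ∷ xs) = trans (cong (b * f x +_) (sum-map-* b f xs)) (sym (*-distribˡ-+ b (f x) _))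

sum-swap : {A B : Set} (f : A → B → ℕ) (xs : List A) (ys : List B) →
  sum (map (λ x → sum (map (f x) ys)) xs) ≡ sum (map (λ y → sum (map (λ x → f x y) xs)) ys)
sum-swap f []       ys = sym (trans (sum-map-const 0 ys) (*-zeroʳ (length ys)))
sum-swap f (x ∷ xs) ys = trans (cong (sum (map (f x) ys) +_) (sum-swap f xs ys))
                               (sym (sum-map-+ (f x) (λ y → sum (map (λ x → f x y) xs)) ys))

length-filter≡sum : {A : Set} {P : A → Set} (P? : Decidable P) (xs : List A) →
  length (filter P? xs) ≡ sum (map (λ x → length (filter P? (x ∷ []))) xs)
length-filter≡sum P? []       = refl
length-filter≡sum P? (x ∷ xs) = trans (length-filter-cons P? x xs) (cong (_ +_) (length-filter≡sum P? xs))

module _ {A B : Set} {R : A → B → Set} (R? : ∀ x y → Dec (R x y)) where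

  private
    indicator-flip : ∀ x y → length (filter (R? x) (y ∷ [])) ≡ length (filter (λ x → R? x y) (x ∷ []))
    indicator-flip x y with R? x y
    ... | yes _ = refl
    ... | no  _ = refl

  double-count : ∀ xs ys → sum (map (λ x → length (filter (R? x) ys)) xs) ≡
                           sum (map (λ y → length (filter (λ x → R? x y) xs)) ys)
  double-count xs ys = begin
    sum (map (λ x → length (filter (R? x) ys)) xs)
      ≡⟨ cong sum (map-cong (λ x → trans (length-filter≡sum (R? x) ys) (cong sum (map-cong (indicator-flip x) ys))) xs) ⟩
    sum (map (λ x → sum (map (λ y → length (filter (λ x → R? x y) (x ∷ []))) ys)) xs)
      ≡⟨ sum-swap (λ x y → length (filter (λ x → R? x y) (x ∷ []))) xs ys ⟩
    sum (map (λ y → sum (map (λ x → length (filter (λ x → R? x y) (x ∷ []))) xs)) ys)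
      ≡⟨ cong sum (map-cong (λ y → sym (length-filter≡sum (λ x → R? x y) xs)) ys) ⟩
    sum (map (λ y → length (filter (λ x → R? x y) xs)) ys) ∎
    where
    open ≡-Reasoning

  union-bound : ∀ xs ys → (∀ {x} → x ∈ xs → ∃[ y ] (y ∈ ys × R x y)) →
    length xs ≤ sum (map (λ y → length (filter (λ x → R? x y) xs)) ys)
  union-bound xs ys covered = begin
    length xs                                               ≡⟨ *-identityʳ _ ⟨
    length xs * 1                                           ≡⟨ sum-map-const 1 xs ⟨
    sum (map (λ _ → 1) xs)                                  ≤⟨ sum-map-mono xs atLeastOne ⟩
    sum (map (λ x → length (filter (R? x) ys)) xs)          ≡⟨ double-count xs ys ⟩
    sum (map (λ y → length (filter (λ x → R? x y) xs)) ys)  ∎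
    where
    open ≤-Reasoning
    atLeastOne : ∀ {x} → x ∈ xs → 1 ≤ length (filter (R? x) ys)
    atLeastOne {x} x∈xs with covered x∈xs
    ... | y , y∈ys , r = filter-some (R? x) (lose y∈ys r)

-- Every term pays `t`, and only the terms in `P` pay the surplus `d`. It is applied with `P`
-- meaning large degree.
sum-map-two-level : {A : Set} {P : A → Set} (P? : Decidable P) (f : A → ℕ) (t d : ℕ) (xs : List A) →
  (∀ {x} → x ∈ xs → f x ≤ t + d) → (∀ {x} → ¬ P x → f x ≤ t) →
  sum (map f xs) ≤ length xs * t + length (filter P? xs) * d
sum-map-two-level P? f t d []       f≤ f≤t = z≤n
sum-map-two-level P? f t d (x ∷ xs) f≤ f≤t with P? x | sum-map-two-level P? f t d xs (f≤ ∘ there) f≤t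
... | yes _ | ih = ≤-trans (+-mono-≤ (f≤ (here refl)) ih) (≤-reflexive (interchange t d _ _))
... | no ¬p | ih = ≤-trans (+-mono-≤ (f≤t ¬p) ih) (≤-reflexive (sym (+-assoc t _ _)))

-- A Markov-type count: entries outside `P` contribute at least `d` each, and the last summand pays
-- for the entries in `P`.
length*≤sum-map : {A : Set} {P : A → Set} (P? : Decidable P) (f : A → ℕ) (d : ℕ) (xs : List A) →
  (∀ {x} → ¬ P x → d ≤ f x) →
  length xs * d ≤ sum (map f xs) + length (filter P? xs) * d
length*≤sum-map P? f d []       d≤f = z≤n
length*≤sum-map P? f d (x ∷ xs) d≤f with P? x | length*≤sum-map P? f d xs d≤f
... | yes _ | ih = begin
  d + length xs * d        ≤⟨ +-monoʳ-≤ d ih ⟩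
  d + (S + l * d)          ≡⟨ x∙yz≈y∙xz d S (l * d) ⟩
  S + (d + l * d)          ≤⟨ m≤n+m _ (f x) ⟩
  f x + (S + (d + l * d))  ≡⟨ +-assoc (f x) S _ ⟨
  f x + S + (d + l * d)    ∎
  where
  open ≤-Reasoning
  S = sum (map f xs)
  l = length (filter P? xs)
... | no ¬p | ih = ≤-trans (+-mono-≤ (d≤f ¬p) ih) (≤-reflexive (sym (+-assoc (f x) _ _)))

-- A repetition under `g` would be a repetition under `f`. In this way distinct edges through `v`
-- yield distinct link edges and, for a proper colouring, distinct colours.
Unique-map-coarser : {A B C : Set} {f : A → B} {g : A → C} {xs : List A} → Unique (map f xs) →
  (∀ {x y} → x ∈ xs → y ∈ xs → g x ≡ g y → f x ≡ f y) → Unique (map g xs)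
Unique-map-coarser {xs = []}     _         g⇒f = []
Unique-map-coarser {xs = x ∷ xs} (fx∉ ∷ u) g⇒f =
  All.map⁺ (All.tabulate (λ y∈xs gx≡gy → All.lookup (All.map⁻ fx∉) y∈xs (g⇒f (here refl) (there y∈xs) gx≡gy)))
  ∷ Unique-map-coarser u (λ x∈ y∈ → g⇒f (there x∈) (there y∈))

Unique-map-filter : {A B : Set} {P : A → Set} (P? : Decidable P) {f : A → B} {xs : List A} →
  Unique (map f xs) → Unique (map f (filter P? xs))
Unique-map-filter P? u = AllPairs.map⁺ (AllPairs.filter⁺ P? (AllPairs.map⁻ u))

-- Subsets and uniform families of coloured edges

_≟ˢ_ : DecidableEquality (Subset n)
_≟ˢ_ = ≡-dec Bool._≟_

elements : Subset n → List (Fin n)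
elements {n} p = filter (_∈? p) (allFin n)

∈-elements⁺ : {x : Fin n} {p : Subset n} → x ∈ˢ p → x ∈ elements p
∈-elements⁺ {p = p} = ∈-filter⁺ (_∈? p) (∈-allFin _)

∈-elements⁻ : {x : Fin n} {p : Subset n} → x ∈ elements p → x ∈ˢ p
∈-elements⁻ {p = p} x∈ = proj₂ (∈-filter⁻ (_∈? p) {xs = allFin _} x∈)

elements-unique : (p : Subset n) → Unique (elements p)
elements-unique {n} p = Unique.filter⁺ (_∈? p) (Unique.allFin⁺ n)

private
  length-elements-tail : ∀ b (p : Subset n) → length (filter (_∈? (b ∷ p)) (tabulate suc)) ≡ length (elements p)
  length-elements-tail {n} b p = begin
    length (filter (_∈? (b ∷ p)) (tabulate suc))         ≡⟨ cong (length ∘ filter (_∈? (b ∷ p))) (map-tabulate id suc) ⟨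
    length (filter (_∈? (b ∷ p)) (map suc (allFin n)))   ≡⟨ length-filter-map (_∈? (b ∷ p)) suc (allFin n) ⟩
    length (filter (λ x → suc x ∈? (b ∷ p)) (allFin n))  ≡⟨ ≤-antisym (length-filter-mono _ _ drop-there (allFin n)) (length-filter-mono _ _ there (allFin n)) ⟩
    length (elements p)                                  ∎
    where open ≡-Reasoning

length-elements : (p : Subset n) → length (elements p) ≡ ∣ p ∣
length-elements []          = refl
length-elements (true ∷ p)  = cong suc (trans (length-elements-tail true p) (length-elements p))
length-elements (false ∷ p) = trans (length-elements-tail false p) (length-elements p)

x∉p-x : (p : Subset n) (x : Fin n) → x ∉ˢ p - x
x∉p-x (b ∷ p) zero    ()
x∉p-x (b ∷ p) (suc x) (there x∈) = x∉p-x p x x∈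

∈-p-x⁻ : {p : Subset n} {x y : Fin n} → y ∈ˢ p - x → y ∈ˢ p × y ≢ x
∈-p-x⁻ {p = p} {x} y∈ = p─q⊆p p ⁅ x ⁆ y∈ , λ { refl → x∉p-x p x y∈ }

suc∣p-x∣≡∣p∣ : {p : Subset n} {x : Fin n} → x ∈ˢ p → suc ∣ p - x ∣ ≡ ∣ p ∣
suc∣p-x∣≡∣p∣ {p = true ∷ p}  here       = cong (suc ∘ ∣_∣) (p─⊥≡p p)
suc∣p-x∣≡∣p∣ {p = true ∷ p}  (there x∈) = cong suc (suc∣p-x∣≡∣p∣ x∈)
suc∣p-x∣≡∣p∣ {p = false ∷ p} (there x∈) = suc∣p-x∣≡∣p∣ x∈

p-x≡q-x⇒p≡q : {p q : Subset n} {x : Fin n} → x ∈ˢ p → x ∈ˢ q → p - x ≡ q - x → p ≡ q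
p-x≡q-x⇒p≡q x∈p x∈q eq = ⊆-antisym (half x∈q eq) (half x∈p (sym eq))
  where
  half : {p q : Subset n} {x : Fin n} → x ∈ˢ q → p - x ≡ q - x → p ⊆ q
  half {x = x} x∈q eq {y} y∈p with y ≟ x
  ... | yes refl = x∈q
  ... | no  y≢x  = proj₁ (∈-p-x⁻ (subst (y ∈ˢ_) eq (x∈p∧x≢y⇒x∈p-y y∈p y≢x)))

subsetsOfSize : Subset n → ℕ → List (Subset n)
subsetsOfSize []          zero    = [] ∷ []
subsetsOfSize []          (suc k) = []
subsetsOfSize (false ∷ p) k       = map (outside ∷_) (subsetsOfSize p k)
subsetsOfSize (true ∷ p)  zero    = map (outside ∷_) (subsetsOfSize p zero)
subsetsOfSize (true ∷ p)  (suc k) = map (inside ∷_) (subsetsOfSize p k) ++ map (outside ∷_) (subsetsOfSize p (suc k))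

length-subsetsOfSize : (p : Subset n) (k : ℕ) → length (subsetsOfSize p k) ≡ ∣ p ∣ C k
length-subsetsOfSize []          zero    = refl
length-subsetsOfSize []          (suc k) = refl
length-subsetsOfSize (false ∷ p) k       = trans (length-map _ (subsetsOfSize p k)) (length-subsetsOfSize p k)
length-subsetsOfSize (true ∷ p)  zero    = trans (length-map _ (subsetsOfSize p zero)) (length-subsetsOfSize p zero)
length-subsetsOfSize (true ∷ p)  (suc k) = begin
  length (map (inside ∷_) (subsetsOfSize p k) ++ map (outside ∷_) (subsetsOfSize p (suc k)))
    ≡⟨ length-++ (map (inside ∷_) (subsetsOfSize p k)) ⟩
  length (map (inside ∷_) (subsetsOfSize p k)) + length (map (outside ∷_) (subsetsOfSize p (suc k)))
    ≡⟨ cong₂ _+_ (trans (length-map _ (subsetsOfSize p k)) (length-subsetsOfSize p k))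
                 (trans (length-map _ (subsetsOfSize p (suc k))) (length-subsetsOfSize p (suc k))) ⟩
  ∣ p ∣ C k + ∣ p ∣ C suc k
    ≡⟨ nCk+nC[k+1]≡[n+1]C[k+1] ∣ p ∣ k ⟩
  suc ∣ p ∣ C suc k ∎
  where open ≡-Reasoning

∈-subsetsOfSize : (p q : Subset n) → q ⊆ p → q ∈ subsetsOfSize p ∣ q ∣
∈-subsetsOfSize []          []          q⊆p = here refl
∈-subsetsOfSize (false ∷ p) (true ∷ q)  q⊆p = contradiction (q⊆p here) λ ()
∈-subsetsOfSize (false ∷ p) (false ∷ q) q⊆p = ∈-map⁺ _ (∈-subsetsOfSize p q (drop-∷-⊆ q⊆p))
∈-subsetsOfSize (true ∷ p)  (true ∷ q)  q⊆p = ∈-++⁺ˡ (∈-map⁺ _ (∈-subsetsOfSize p q (drop-∷-⊆ q⊆p)))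
∈-subsetsOfSize (true ∷ p)  (false ∷ q) q⊆p with ∣ q ∣ | ∈-subsetsOfSize p q (drop-∷-⊆ q⊆p)
... | zero  | q∈ = ∈-map⁺ _ q∈
... | suc l | q∈ = ∈-++⁺ʳ _ (∈-map⁺ _ q∈)

Family : ℕ → Set
Family n = List (Subset n × ℕ)

edges : Family n → List (Subset n)
edges = map proj₁

colours : Family n → List ℕ
colours = map proj₂

-- Removing v from the edges of the link keeps the colours, so that a proper colouring becomes injective on the link.
link : Fin n → Family n → Family n
link v F = map (map₁ (_- v)) (filter (λ x → v ∈? proj₁ x) F)

deg : Family n → Fin n → ℕ
deg F v = length (filter (λ x → v ∈? proj₁ x) F)

length-link : (v : Fin n) (F : Family n) → length (link v F) ≡ deg F v
length-link v F = length-map _ (filter (λ x → v ∈? proj₁ x) F)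

∈-link⁻ : (v : Fin n) {F : Family n} {x : Subset n × ℕ} → x ∈ link v F →
  ∃[ e ] ((e , proj₂ x) ∈ F × v ∈ˢ e × proj₁ x ≡ e - v)
∈-link⁻ v {F} x∈ with ∈-map⁻ (map₁ (_- v)) x∈
... | (e , c) , y∈ , refl with ∈-filter⁻ (λ x → v ∈? proj₁ x) {xs = F} y∈
... | ec∈ , v∈e = e , ec∈ , v∈e , refl

-- Deleting a vertex shrinks `A` and leaves the ambient `n` alone, so no induction has to rename
-- vertices. Since `distinct` concerns edges without colours, each edge carries a single colour.
record Uniform (A : Subset n) (k : ℕ) (F : Family n) : Set where
  field
    distinct : Unique (edges F)
    within   : ∀ {e c} → (e , c) ∈ F → e ⊆ A
    size     : ∀ {e c} → (e , c) ∈ F → ∣ e ∣ ≡ k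
open Uniform

Uniform-filter : {A : Subset n} {F : Family n} {P : Subset n × ℕ → Set} (P? : Decidable P) →
  Uniform A k F → Uniform A k (filter P? F)
Uniform-filter {F = F} P? U = record
  { distinct = Unique-map-filter P? (distinct U)
  ; within   = λ x∈ → within U (proj₁ (∈-filter⁻ P? {xs = F} x∈))
  ; size     = λ x∈ → size U (proj₁ (∈-filter⁻ P? {xs = F} x∈))
  }

Uniform-link : {A : Subset n} {F : Family n} (v : Fin n) → Uniform A (suc k) F → Uniform (A - v) k (link v F)
Uniform-link {A = A} {F} v U = record
  { distinct = subst Unique (map-∘ (filter (λ x → v ∈? proj₁ x) F))
      (Unique-map-coarser (Unique-map-filter (λ x → v ∈? proj₁ x) (distinct U))
        (λ x∈ y∈ → p-x≡q-x⇒p≡q (v∈ x∈) (v∈ y∈)))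
  ; within   = λ x∈ → link-within (∈-link⁻ v x∈)
  ; size     = λ x∈ → link-size (∈-link⁻ v x∈)
  }
  where
  v∈ : ∀ {x} → x ∈ filter (λ x → v ∈? proj₁ x) F → v ∈ˢ proj₁ x
  v∈ x∈ = proj₂ (∈-filter⁻ (λ x → v ∈? proj₁ x) {xs = F} x∈)

  link-within : ∀ {e′ c} → ∃[ e ] ((e , c) ∈ F × v ∈ˢ e × e′ ≡ e - v) → e′ ⊆ A - v
  link-within (e , ec∈ , v∈e , refl) y∈ with ∈-p-x⁻ {p = e} y∈
  ... | y∈e , y≢v = x∈p∧x≢y⇒x∈p-y (within U ec∈ y∈e) y≢v

  link-size : ∀ {e′ c} → ∃[ e ] ((e , c) ∈ F × v ∈ˢ e × e′ ≡ e - v) → ∣ e′ ∣ ≡ _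
  link-size (e , ec∈ , v∈e , refl) = suc-injective (trans (suc∣p-x∣≡∣p∣ v∈e) (size U ec∈))

length≤C : {A : Subset n} {F : Family n} → Uniform A k F → length F ≤ ∣ A ∣ C k
length≤C {k = k} {A} {F} U = begin
  length F                    ≡⟨ length-map proj₁ F ⟨
  length (edges F)            ≤⟨ Unique⊆⇒length≤ (distinct U) edges⊆ ⟩
  length (subsetsOfSize A k)  ≡⟨ length-subsetsOfSize A k ⟩
  ∣ A ∣ C k                   ∎
  where
  open ≤-Reasoning
  edges⊆ : ∀ {e} → e ∈ edges F → e ∈ subsetsOfSize A k
  edges⊆ e∈ with ∈-map⁻ proj₁ e∈
  ... | (e , c) , ec∈ , refl = subst (λ l → e ∈ subsetsOfSize A l) (size U ec∈) (∈-subsetsOfSize A e (within U ec∈))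

0<deg⇒∈ : {F : Family n} (v : Fin n) → 0 < deg F v → ∃[ x ] (x ∈ F × v ∈ˢ proj₁ x)
0<deg⇒∈ {F = F} v 0<d = find (go F 0<d)
  where
  go : ∀ F → 0 < deg F v → Any (λ x → v ∈ˢ proj₁ x) F
  go (x ∷ F) 0<d with v ∈? proj₁ x
  ... | yes v∈ = here v∈
  ... | no  _  = there (go F 0<d)

deg≤C : {A : Subset n} {F : Family n} → ∣ A ∣ ≡ suc m → Uniform A (suc k) F → ∀ v → deg F v ≤ m C k
deg≤C {m = m} {k} {A} {F} ∣A∣ U v with deg F v in eq
-- The size of `A - v` is known only for `v` in `A`, which an edge through `v` guarantees; degree 0
-- is therefore split off.
... | zero = z≤n
... | suc d with 0<deg⇒∈ {F = F} v (subst (0 <_) (sym eq) z<s)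
... | (e , c) , ec∈ , v∈e = begin
  suc d            ≡⟨ trans (length-link v F) eq ⟨
  length (link v F) ≤⟨ length≤C (Uniform-link v U) ⟩
  ∣ A - v ∣ C k    ≡⟨ cong (_C k) (suc-injective (trans (suc∣p-x∣≡∣p∣ (within U ec∈ v∈e)) ∣A∣)) ⟩
  m C k            ∎
  where open ≤-Reasoning

codeg≤C : {A : Subset n} {F : Family n} → ∣ A ∣ ≡ 2 + m → Uniform A (2 + k) F → ∀ u v → deg (link u F) v ≤ m C k
codeg≤C {A = A} {F} ∣A∣ U u v with deg (link u F) v in eq
... | zero = z≤n
... | suc d with 0<deg⇒∈ {F = link u F} v (subst (0 <_) (sym eq) z<s)
... | x , x∈ , _ with ∈-link⁻ u {F} x∈
... | e , ec∈ , u∈e , _ = ≤-trans (≤-reflexive (sym eq))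
  (deg≤C (suc-injective (trans (suc∣p-x∣≡∣p∣ (within U ec∈ u∈e)) ∣A∣)) (Uniform-link u U) v)

-- Incidences are counted from the side of the edges: `xs` has no repetitions, so an edge is met at
-- most `k` times.
sum-deg : {A : Subset n} {F : Family n} → Uniform A k F → {xs : List (Fin n)} → Unique xs → sum (map (deg F) xs) ≤ length F * k
sum-deg {k = k} {F = F} U {xs} u = begin
  sum (map (deg F) xs)                                        ≡⟨ double-count (λ v x → v ∈? proj₁ x) xs F ⟩
  sum (map (λ x → length (filter (_∈? proj₁ x) xs)) F)        ≤⟨ sum-map≤length* F bound ⟩
  length F * k                                                ∎
  where
  open ≤-Reasoning
  bound : ∀ {x} → x ∈ F → length (filter (_∈? proj₁ x) xs) ≤ k
  bound {e , c} x∈ = begin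
    length (filter (_∈? e) xs)  ≤⟨ Unique⊆⇒length≤ (Unique.filter⁺ (_∈? e) u) (λ y∈ → ∈-elements⁺ (proj₂ (∈-filter⁻ (_∈? e) {xs = xs} y∈))) ⟩
    length (elements e)         ≡⟨ length-elements e ⟩
    ∣ e ∣                       ≡⟨ size U x∈ ⟩
    k                           ∎

-- Both sides count the edges containing `u` and `w`, and both vanish when `u` and `w` coincide. The
-- symmetry allows sums of codegrees to be regrouped by the covered vertex.
codeg-sym : (F : Family n) (u w : Fin n) → deg (link u F) w ≤ deg (link w F) u
codeg-sym F u w = begin
  deg (link u F) w  ≡⟨ codeg-filter u w ⟩
  length (filter (λ x → (w ∈? (proj₁ x - u)) ×-dec (u ∈? proj₁ x)) F)
    ≤⟨ length-filter-mono _ _ (λ {x} → swap {proj₁ x}) F ⟩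
  length (filter (λ x → (u ∈? (proj₁ x - w)) ×-dec (w ∈? proj₁ x)) F)
    ≡⟨ codeg-filter w u ⟨
  deg (link w F) u ∎
  where
  open ≤-Reasoning
  codeg-filter : ∀ u w → deg (link u F) w ≡ length (filter (λ x → (w ∈? (proj₁ x - u)) ×-dec (u ∈? proj₁ x)) F)
  codeg-filter u w = trans (length-filter-map (λ x → w ∈? proj₁ x) (map₁ (_- u)) (filter (λ x → u ∈? proj₁ x) F))
                           (length-filter-filter (λ x → w ∈? (proj₁ x - u)) (λ x → u ∈? proj₁ x) F)
  swap : ∀ {e} → w ∈ˢ e - u × u ∈ˢ e → u ∈ˢ e - w × w ∈ˢ e
  swap {e} (w∈e-u , u∈e) with ∈-p-x⁻ {p = e} w∈e-u
  ... | w∈e , w≢u = x∈p∧x≢y⇒x∈p-y u∈e (w≢u ∘ sym) , w∈e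

-- Rainbow matchings

Compatible : Subset n × ℕ → Subset n × ℕ → Set
Compatible x y = Disjoint (proj₁ x) (proj₁ y) × proj₂ x ≢ proj₂ y

compatible? : (x y : Subset n × ℕ) → Dec (Compatible x y)
compatible? (e , c) (f , d) = ¬? (nonempty? (e ∩ f)) ×-dec ¬? (c ≟ℕ d)

disjoint⁺ : {e f : Subset n} → (∀ {v} → v ∈ˢ e → v ∉ˢ f) → Disjoint e f
disjoint⁺ {e = e} {f} h (v , v∈) with x∈p∩q⁻ e f v∈
... | v∈e , v∈f = h v∈e v∈f

Compatible-sym : {x y : Subset n × ℕ} → Compatible x y → Compatible y x
Compatible-sym (disj , c≢d) = disjoint⁺ (λ v∈f v∈e → disj (_ , x∈p∩q⁺ (v∈e , v∈f))) , c≢d ∘ sym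

CompatibleWithAll : (Fin s → Subset n × ℕ) → Subset n × ℕ → Set
CompatibleWithAll ys x = ∀ j → Compatible x (ys j)

Rainbow : (Fin s → Family n) → Set
Rainbow {s} {n} F = Σ[ x ∈ (Fin s → Subset n × ℕ) ] (∀ i → x i ∈ F i) × (∀ i j → i ≢ j → Compatible (x i) (x j))

Rainbow-mono : {F G : Fin s → Family n} → (∀ i {x} → x ∈ F i → x ∈ G i) → Rainbow F → Rainbow G
Rainbow-mono F⊆G (x , x∈F , compat) = x , (λ i → F⊆G i (x∈F i)) , compat

punchIn-cases : (i : Fin (suc s)) (P : Fin (suc s) → Set) → P i → (∀ j → P (punchIn i j)) → ∀ j → P j
punchIn-cases i P pᵢ pⱼ j with i ≟ j
... | yes refl = pᵢ
... | no  i≢j  = subst P (punchIn-punchOut i≢j) (pⱼ (punchOut i≢j))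

Rainbow-insert : (F : Fin (suc s) → Family n) (i : Fin (suc s)) (R : Rainbow (removeAt F i)) {x : Subset n × ℕ} →
  x ∈ F i → CompatibleWithAll (proj₁ R) x → Rainbow F
Rainbow-insert F i (ys , ys∈ , compat) {x} x∈ x-compat = zs , zs∈ , zs-compat
  where
  zs = insertAt ys i x
  zsᵢ : zs i ≡ x
  zsᵢ = insertAt-lookup ys i x
  zsⱼ : ∀ j → zs (punchIn i j) ≡ ys j
  zsⱼ = insertAt-punchIn ys i x

  zs∈ : ∀ j → zs j ∈ F j
  zs∈ = punchIn-cases i _ (subst (_∈ F i) (sym zsᵢ) x∈) (λ j → subst (_∈ F (punchIn i j)) (sym (zsⱼ j)) (ys∈ j))

  zs-compat : ∀ a b → a ≢ b → Compatible (zs a) (zs b)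
  zs-compat = punchIn-cases i _
    (punchIn-cases i _ (λ i≢i → contradiction refl i≢i)
      (λ j _ → subst₂ Compatible (sym zsᵢ) (sym (zsⱼ j)) (x-compat j)))
    (λ j → punchIn-cases i _ (λ _ → subst₂ Compatible (sym (zsⱼ j)) (sym zsᵢ) (Compatible-sym (x-compat j)))
      (λ j′ j≢j′ → subst₂ Compatible (sym (zsⱼ j)) (sym (zsⱼ j′)) (compat j j′ (j≢j′ ∘ cong (punchIn i)))))

module _ (ys : Fin s → Subset n × ℕ) where

  covered : List (Fin n)
  covered = filter (λ v → any? (λ j → v ∈? proj₁ (ys j))) (allFin n)

  covered-unique : Unique covered
  covered-unique = Unique.filter⁺ _ (Unique.allFin⁺ n)

  ∈-covered⁺ : ∀ {v} j → v ∈ˢ proj₁ (ys j) → v ∈ covered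
  ∈-covered⁺ j v∈ = ∈-filter⁺ _ (∈-allFin _) (j , v∈)

  ∈-covered⁻ : ∀ {v} → v ∈ covered → ∃[ j ] (v ∈ˢ proj₁ (ys j))
  ∈-covered⁻ v∈ = proj₂ (∈-filter⁻ (λ v → any? (λ j → v ∈? proj₁ (ys j))) {xs = allFin n} v∈)

  length-covered : (∀ j → ∣ proj₁ (ys j) ∣ ≡ k) → length covered ≤ s * k
  length-covered {k} sizes = begin
    length covered                                         ≤⟨ Unique⊆⇒length≤ covered-unique (λ v∈ → listed (∈-covered⁻ v∈)) ⟩
    length (concat (tabulate (elements ∘ proj₁ ∘ ys)))     ≡⟨ length-concat-tabulate _ (λ j → trans (length-elements (proj₁ (ys j))) (sizes j)) ⟩
    s * k                                                  ∎
    where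
    open ≤-Reasoning
    listed : ∀ {v} → ∃[ j ] (v ∈ˢ proj₁ (ys j)) → v ∈ concat (tabulate (elements ∘ proj₁ ∘ ys))
    listed (j , v∈) = ∈-concat⁺′ (∈-elements⁺ v∈) (∈-tabulate⁺ {f = elements ∘ proj₁ ∘ ys} j)
    length-concat-tabulate : ∀ {s} (f : Fin s → List (Fin n)) → (∀ j → length (f j) ≡ k) → length (concat (tabulate f)) ≡ s * k
    length-concat-tabulate {zero}  f h = refl
    length-concat-tabulate {suc s} f h =
      trans (length-++ (f zero)) (cong₂ _+_ (h zero) (length-concat-tabulate (f ∘ suc) (h ∘ suc)))

touches? : (W : List (Fin n)) (x : Subset n × ℕ) → Dec (Any (_∈ˢ proj₁ x) W)
touches? W x = Any.any? (_∈? proj₁ x) W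

avoiding : List (Fin n) → Family n → Family n
avoiding W F = filter (¬? ∘ touches? W) F

∈-avoiding⁻ : (W : List (Fin n)) {F : Family n} {x : Subset n × ℕ} → x ∈ avoiding W F → x ∈ F × (∀ {v} → v ∈ W → v ∉ˢ proj₁ x)
∈-avoiding⁻ W {F} x∈ with ∈-filter⁻ (¬? ∘ touches? W) {xs = F} x∈
... | x∈F , avoids = x∈F , λ v∈W v∈x → avoids (lose v∈W v∈x)

∈-avoiding⁺ : (W : List (Fin n)) {F : Family n} {x : Subset n × ℕ} → x ∈ F → (∀ {v} → v ∈ W → v ∉ˢ proj₁ x) → x ∈ avoiding W F
∈-avoiding⁺ W x∈ avoids = ∈-filter⁺ (¬? ∘ touches? W) x∈ (λ t → let v , v∈W , v∈x = find t in avoids v∈W v∈x)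

length-avoiding : (W : List (Fin n)) (F : Family n) → length F ≤ sum (map (deg F) W) + length (avoiding W F)
length-avoiding W F = begin
  length F                                                             ≡⟨ length-filter-split (touches? W) F ⟩
  length F′ + length (avoiding W F)                                    ≤⟨ +-monoˡ-≤ _ (union-bound (λ x w → w ∈? proj₁ x) F′ W covers) ⟩
  sum (map (deg F′) W) + length (avoiding W F)                         ≤⟨ +-monoˡ-≤ _ (sum-map-mono W (λ {w} _ → deg-mono w)) ⟩
  sum (map (deg F) W) + length (avoiding W F)                          ∎
  where
  open ≤-Reasoning
  F′ = filter (touches? W) F
  covers : ∀ {x} → x ∈ F′ → ∃[ w ] (w ∈ W × w ∈ˢ proj₁ x)
  covers x∈ = find (proj₂ (∈-filter⁻ (touches? W) {xs = F} x∈))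
  deg-mono : ∀ w → deg F′ w ≤ deg F w
  deg-mono w = ≤-trans (≤-reflexive (length-filter-filter (λ x → w ∈? proj₁ x) (touches? W) F)) (length-filter-mono _ _ proj₁ F)

compatibleEdge? : (F : Family n) (ys : Fin s → Subset n × ℕ) → Dec (∃[ x ] (x ∈ F × CompatibleWithAll ys x))
compatibleEdge? F ys with Any.any? (λ x → all? (λ j → compatible? x (ys j))) F
... | yes p = yes (find p)
... | no ¬p = no (λ { (x , x∈ , compat) → ¬p (lose x∈ compat) })

-- An edge that misses all covered vertices is disjoint from the whole matching, so it can fail only
-- by repeating one of its `s` colours. As colours are injective on `G`, there are at most `s` such
-- edges; the others are charged to the covered vertices they meet.
conflicts-bound : {G : Family n} (ys : Fin s → Subset n × ℕ) → Unique (colours G) →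
  ¬ (∃[ x ] (x ∈ G × CompatibleWithAll ys x)) → length G ≤ sum (map (deg G) (covered ys)) + s
conflicts-bound {s = s} {G} ys u none = ≤-trans (length-avoiding (covered ys) G) (+-monoʳ-≤ _ (begin
  length G′                        ≡⟨ length-map proj₂ G′ ⟨
  length (colours G′)              ≤⟨ Unique⊆⇒length≤ (Unique-map-filter (¬? ∘ touches? (covered ys)) u) colours⊆ ⟩
  length (tabulate (proj₂ ∘ ys))   ≡⟨ length-tabulate (proj₂ ∘ ys) ⟩
  s                                ∎))
  where
  open ≤-Reasoning
  G′ = avoiding (covered ys) G
  colours⊆ : ∀ {c} → c ∈ colours G′ → c ∈ tabulate (proj₂ ∘ ys)
  colours⊆ c∈ with ∈-map⁻ proj₂ c∈
  ... | (e , c) , x∈ , refl with ∈-avoiding⁻ (covered ys) {G} x∈ | any? (λ j → c ≟ℕ proj₂ (ys j))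
  ... | _         , _      | yes (j , refl) = ∈-tabulate⁺ {f = proj₂ ∘ ys} j
  ... | x∈G       , avoids | no ¬same       = contradiction
    ((e , c) , x∈G , λ j → disjoint⁺ (λ v∈e v∈y → avoids (∈-covered⁺ ys j v∈y) v∈e) , λ c≡ → ¬same (j , c≡)) none

-- Since `u` is uncovered, `e - u` is compatible with the matching exactly when `e` is, so
-- `conflicts-bound` applies to the link of `u`. Only there must colours be injective, which proper
-- colourings satisfy.
link-conflicts-bound : {F : Family n} (ys : Fin s → Subset n × ℕ) (u : Fin n) → u ∉ covered ys → Unique (colours (link u F)) →
  ¬ (∃[ x ] (x ∈ F × CompatibleWithAll ys x)) → deg F u ≤ sum (map (deg (link u F)) (covered ys)) + s
link-conflicts-bound {F = F} ys u u∉ uniq none =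
  ≤-trans (≤-reflexive (sym (length-link u F))) (conflicts-bound ys uniq (none ∘ unlink))
  where
  unlink : ∃[ x ] (x ∈ link u F × CompatibleWithAll ys x) → ∃[ x ] (x ∈ F × CompatibleWithAll ys x)
  unlink (x , x∈ , compat) with ∈-link⁻ u {F} x∈
  ... | e , ec∈ , u∈e , refl = (e , proj₂ x) , ec∈ , λ j →
    disjoint⁺ (λ {v} v∈e v∈y → proj₁ (compat j) (v , x∈p∩q⁺ (x∈p∧x≢y⇒x∈p-y v∈e (λ { refl → u∉ (∈-covered⁺ ys j v∈y) }) , v∈y)))
    , proj₂ (compat j)

-- The matching covers at most `s * k` vertices, none of them `v`. Each spoils at most `b` edges
-- through `v`, and the `s` colours spoil at most `s` more, so a degree above `s * (k * b + 1)`
-- leaves a usable edge.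
Rainbow-extend : (F : Fin (suc s) → Family n) (i : Fin (suc s)) (v : Fin n) {b : ℕ} →
  (∀ j {e c} → (e , c) ∈ F j → ∣ e ∣ ≡ k) → (∀ w → deg (link v (F i)) w ≤ b) → Unique (colours (link v (F i))) →
  s * (k * b + 1) < deg (F i) v → Rainbow (λ j → avoiding (v ∷ []) (F (punchIn i j))) → Rainbow F
Rainbow-extend {s = s} {k = k} F i v {b} sizes codeg≤b uniq heavy R@(ys , ys∈ , _) with compatibleEdge? (F i) ys
... | yes (x , x∈ , compat) = Rainbow-insert F i (Rainbow-mono {G = removeAt F i} (λ j → proj₁ ∘ ∈-avoiding⁻ (v ∷ []) {F (punchIn i j)}) R) x∈ compat
... | no none = contradiction (begin
  deg (F i) v                                          ≤⟨ link-conflicts-bound ys v v∉ uniq none ⟩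
  sum (map (deg (link v (F i))) (covered ys)) + s      ≤⟨ +-monoˡ-≤ s (sum-map≤length* (covered ys) (λ {w} _ → codeg≤b w)) ⟩
  length (covered ys) * b + s                          ≤⟨ +-monoˡ-≤ s (*-monoˡ-≤ b (length-covered ys (λ j → sizes (punchIn i j) (proj₁ (split j (ys∈ j)))))) ⟩
  s * k * b + s                                        ≡⟨ cong₂ _+_ (*-assoc s k b) (sym (*-identityʳ s)) ⟩
  s * (k * b) + s * 1                                  ≡⟨ *-distribˡ-+ s (k * b) 1 ⟨
  s * (k * b + 1)                                      ∎) (<⇒≱ heavy)
  where
  open ≤-Reasoning
  split : ∀ j {x} → x ∈ avoiding (v ∷ []) (F (punchIn i j)) → x ∈ F (punchIn i j) × (∀ {w} → w ∈ v ∷ [] → w ∉ˢ proj₁ x)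
  split j = ∈-avoiding⁻ (v ∷ []) {F (punchIn i j)}
  v∉ : v ∉ covered ys
  v∉ v∈ with ∈-covered⁻ ys v∈
  ... | j , v∈y = proj₂ (split j (ys∈ j)) (here refl) v∈y

-- Each link edge gets its vertex `v i` back. A common vertex of two of the resulting edges is
-- `v i`, which the other edge avoids, or symmetrically `v j`, or else already lies in both link
-- edges.
Rainbow-links : (F : Fin (suc s) → Family n) (v : Fin (suc s) → Fin n) → (∀ {i j} → v i ≡ v j → i ≡ j) →
  Rainbow (λ i → avoiding (tabulate (removeAt v i)) (link (v i) (F i))) → Rainbow F
Rainbow-links {s = s} {n} F v v-inj (xs , xs∈ , compat) = ys , ys∈F , ys-compat
  where
  unlink : ∀ i → ∃[ e ] ((e , proj₂ (xs i)) ∈ F i × v i ∈ˢ e × proj₁ (xs i) ≡ e - v i)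
  unlink i = ∈-link⁻ (v i) {F i} (proj₁ (∈-avoiding⁻ (tabulate (removeAt v i)) {link (v i) (F i)} (xs∈ i)))
  e : Fin (suc s) → Subset n
  e i = proj₁ (unlink i)
  ys : Fin (suc s) → Subset n × ℕ
  ys i = e i , proj₂ (xs i)
  ys∈F : ∀ i → ys i ∈ F i
  ys∈F i = proj₁ (proj₂ (unlink i))
  e-v : ∀ i → proj₁ (xs i) ≡ e i - v i
  e-v i = proj₂ (proj₂ (proj₂ (unlink i)))

  v∉e : ∀ i j → i ≢ j → v j ∉ˢ e i
  v∉e i j i≢j vⱼ∈ = proj₂ (∈-avoiding⁻ (tabulate (removeAt v i)) {link (v i) (F i)} (xs∈ i))
    (subst (_∈ tabulate (removeAt v i)) (cong v (punchIn-punchOut i≢j)) (∈-tabulate⁺ {f = removeAt v i} (punchOut i≢j)))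
    (subst (v j ∈ˢ_) (sym (e-v i)) (x∈p∧x≢y⇒x∈p-y vⱼ∈ (λ vⱼ≡vᵢ → i≢j (v-inj (sym vⱼ≡vᵢ)))))

  ys-compat : ∀ i j → i ≢ j → Compatible (ys i) (ys j)
  ys-compat i j i≢j = disjoint⁺ disj , proj₂ (compat i j i≢j)
    where
    disj : ∀ {w} → w ∈ˢ e i → w ∉ˢ e j
    disj {w} w∈i w∈j with w ≟ v i | w ≟ v j
    ... | yes refl | _        = contradiction w∈j (v∉e j i (i≢j ∘ sym))
    ... | no _     | yes refl = contradiction w∈i (v∉e i j i≢j)
    ... | no w≢vᵢ  | no w≢vⱼ  = contradiction (w , x∈p∩q⁺ (subst (w ∈ˢ_) (sym (e-v i)) (x∈p∧x≢y⇒x∈p-y w∈i w≢vᵢ)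
                                                         , subst (w ∈ˢ_) (sym (e-v j)) (x∈p∧x≢y⇒x∈p-y w∈j w≢vⱼ)))
                                              (proj₁ (compat i j i≢j))

-- Binomial coefficients and the final estimates

C-absorption : ∀ n k → suc k * (suc n C suc k) ≡ suc n * (n C k)
C-absorption zero zero    = refl
C-absorption zero (suc k) = trans (cong ((2 + k) *_) (k>n⇒nCk≡0 {1} {2 + k} (s≤s (s≤s z≤n))))
  (trans (*-zeroʳ (2 + k)) (sym (cong (1 *_) (k>n⇒nCk≡0 {0} {suc k} (s≤s z≤n)))))
C-absorption (suc n) zero = trans (*-identityˡ _) (trans (nC1≡n (2 + n)) (sym (*-identityʳ (2 + n))))
C-absorption (suc n) (suc k) = begin
  (2 + k) * ((2 + n) C (2 + k))
    ≡⟨ cong ((2 + k) *_) (nCk+nC[k+1]≡[n+1]C[k+1] (suc n) (suc k)) ⟨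
  (2 + k) * (x + y)
    ≡⟨ rearrange k x y ⟩
  x + (suc k * x + (2 + k) * y)
    ≡⟨ cong (x +_) (cong₂ _+_ (C-absorption n k) (C-absorption n (suc k))) ⟩
  x + (suc n * (n C k) + suc n * (n C suc k))
    ≡⟨ cong (x +_) (*-distribˡ-+ (suc n) (n C k) (n C suc k)) ⟨
  x + suc n * (n C k + n C suc k)
    ≡⟨ cong (λ z → x + suc n * z) (nCk+nC[k+1]≡[n+1]C[k+1] n k) ⟩
  (2 + n) * x ∎
  where
  open ≡-Reasoning
  x = suc n C suc k
  y = suc n C (2 + k)
  rearrange : ∀ k x y → (2 + k) * (x + y) ≡ x + (suc k * x + (2 + k) * y)
  rearrange = solve-∀

C-mono-suc : ∀ n k → n C k ≤ suc n C k
C-mono-suc n zero    = ≤-refl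
C-mono-suc n (suc k) = ≤-trans (m≤n+m (n C suc k) (n C k)) (≤-reflexive (nCk+nC[k+1]≡[n+1]C[k+1] n k))

C-monoˡ-≤ : ∀ k {m n} → m ≤ n → m C k ≤ n C k
C-monoˡ-≤ k m≤n = go (≤⇒≤′ m≤n)
  where
  go : ∀ {m n} → m ≤′ n → m C k ≤ n C k
  go ≤′-refl       = ≤-refl
  go (≤′-step m≤n) = ≤-trans (go m≤n) (C-mono-suc _ k)

C-positive : k ≤ n → 1 ≤ n C k
C-positive {k} {n} k≤n = ≤-trans (≤-reflexive (sym (nCn≡1 k))) (C-monoˡ-≤ k k≤n)

-- The linear bound `C(n, k+1) ≥ n - k`: each step of Pascal's rule adds a positive coefficient.
n<C+k : ∀ {n k} → suc k ≤ n → suc n ≤ n C suc k + suc k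
n<C+k {suc n} {k} (s≤s k≤n) with suc k ≤? n
... | yes k<n = begin
  2 + n                        ≤⟨ s≤s (n<C+k k<n) ⟩
  1 + (n C suc k + suc k)      ≤⟨ +-monoˡ-≤ _ (C-positive k≤n) ⟩
  n C k + (n C suc k + suc k)  ≡⟨ +-assoc (n C k) _ _ ⟨
  n C k + n C suc k + suc k    ≡⟨ cong (_+ suc k) (nCk+nC[k+1]≡[n+1]C[k+1] n k) ⟩
  suc n C suc k + suc k        ∎
  where open ≤-Reasoning
... | no k≮n = +-mono-≤ (C-positive {suc k} {suc n} (s≤s k≤n)) (≰⇒> k≮n)

-- Pascal's rule telescopes: the increment is the sum of `C(n+j, k)` over `j < t`, and every `n + j`
-- is at most `p`.
C-+-upper : ∀ {p} k n t → n + t ≤ suc p → (n + t) C suc k ≤ n C suc k + t * (p C k)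
C-+-upper k n zero    n≤p = ≤-reflexive (trans (cong (_C suc k) (+-identityʳ n)) (sym (+-identityʳ _)))
C-+-upper {p} k n (suc t) n≤p = begin
  (n + suc t) C suc k                  ≡⟨ cong (_C suc k) (+-suc n t) ⟩
  suc (n + t) C suc k                  ≡⟨ nCk+nC[k+1]≡[n+1]C[k+1] (n + t) k ⟨
  (n + t) C k + (n + t) C suc k        ≤⟨ +-mono-≤ (C-monoˡ-≤ k n+t≤p) (C-+-upper k n t (m≤n⇒m≤1+n n+t≤p)) ⟩
  p C k + (n C suc k + t * (p C k))    ≡⟨ rearrange (p C k) (n C suc k) _ ⟩
  n C suc k + suc t * (p C k)          ∎
  where
  open ≤-Reasoning
  n+t≤p : n + t ≤ p
  n+t≤p = s≤s⁻¹ (≤-trans (≤-reflexive (sym (+-suc n t))) n≤p)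
  rearrange : ∀ a b c → a + (b + c) ≡ b + (a + c)
  rearrange = solve-∀

-- The same telescoping sum, with each term bounded below by its first one.
C-+-lower : ∀ k n t → n C suc k + t * (n C k) ≤ (n + t) C suc k
C-+-lower k n zero    = ≤-reflexive (trans (+-identityʳ _) (cong (_C suc k) (sym (+-identityʳ n))))
C-+-lower k n (suc t) = begin
  n C suc k + (n C k + t * (n C k))  ≡⟨ rearrange (n C suc k) (n C k) _ ⟩
  n C k + (n C suc k + t * (n C k))  ≤⟨ +-mono-≤ (C-monoˡ-≤ k (m≤m+n n t)) (C-+-lower k n t) ⟩
  (n + t) C k + (n + t) C suc k      ≡⟨ nCk+nC[k+1]≡[n+1]C[k+1] (n + t) k ⟩
  suc (n + t) C suc k                ≡⟨ cong (_C suc k) (+-suc n t) ⟨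
  (n + suc t) C suc k                ∎
  where
  open ≤-Reasoning
  rearrange : ∀ a b c → a + (b + c) ≡ b + (a + c)
  rearrange = solve-∀

-- For `k = r - 1` this is `oreBound n r s` without its factor `r`.
oreGap : ℕ → ℕ → ℕ → ℕ
oreGap n k s = (n ∸ 1) C k ∸ (n ∸ s) C k

-- With `R = 3 * (3 + k)` and `c = m C suc k`, this says that the gap is at least `(1 - 1/R) s c`.
-- The gap is a sum of `s` coefficients `C(j, k+1)`, the smallest being `y`. By telescoping and
-- absorption, `c - y` is at most `t (k+1) / m` times `c`, where `s = t + 1`.
oreGap-lower : ∀ k s m → 3 * ((3 + k) * (3 + k)) * suc s < 2 + m →
  3 * (3 + k) * (s * (m C suc k)) ≤ 3 * (3 + k) * oreGap (2 + m) (2 + k) (suc s) + s * (m C suc k)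
oreGap-lower k zero    m large = ≤-trans (≤-reflexive (*-zeroʳ (3 * (3 + k)))) z≤n
oreGap-lower k (suc t) zero large = contradiction large (<⇒≱ (s≤s (s≤s (m≤m+n 1 _))))
oreGap-lower k (suc t) m@(suc m′) large = begin
  R * (suc t * c)                    ≡⟨ rearrange₁ R (suc t) c ⟩
  suc t * (R * c)                    ≤⟨ *-monoʳ-≤ (suc t) core ⟩
  suc t * (R * y + c)                ≡⟨ rearrange₂ (suc t) R y c ⟩
  R * (suc t * y) + suc t * c        ≤⟨ +-monoˡ-≤ (suc t * c) (*-monoʳ-≤ R gap) ⟩
  R * oreGap (2 + m) (2 + k) (2 + t) + suc t * c ∎
  where
  open ≤-Reasoning
  R = 3 * (3 + k)
  c = m C suc k
  N = m ∸ t
  y = N C suc k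
  z = m′ C k
  rearrange₁ : ∀ R s c → R * (s * c) ≡ s * (R * c)
  rearrange₁ = solve-∀
  rearrange₂ : ∀ s R y c → s * (R * y + c) ≡ R * (s * y) + s * c
  rearrange₂ = solve-∀
  rearrange₃ : ∀ k t → 3 * (3 + k) * (t * (1 + k)) + (3 * (3 + k) * (6 + 2 * k + 2 * t)) ≡ 3 * ((3 + k) * (3 + k)) * (2 + t)
  rearrange₃ = solve-∀
  rearrange₄ : ∀ m R y t z → m * (R * (y + t * z)) ≡ m * (R * y) + R * t * (m * z)
  rearrange₄ = solve-∀
  rearrange₅ : ∀ m R y t k c → m * (R * y) + R * t * ((1 + k) * c) ≡ m * (R * y) + R * (t * (1 + k)) * c
  rearrange₅ = solve-∀

  -- This is where the size of the vertex set enters: it makes the relative loss `t (k+1) / m` at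
  -- most `1/R`.
  Rt≤m : R * (t * suc k) ≤ m
  Rt≤m = s≤s⁻¹ (s≤s⁻¹ (begin
    2 + R * (t * suc k)                              ≡⟨ +-comm 2 _ ⟩
    R * (t * suc k) + 2                              ≤⟨ +-monoʳ-≤ _ (m≤m+n 2 _) ⟩
    R * (t * suc k) + R * (6 + 2 * k + 2 * t)        ≡⟨ rearrange₃ k t ⟩
    3 * ((3 + k) * (3 + k)) * (2 + t)                ≤⟨ <⇒≤ large ⟩
    2 + m                                            ∎))

  t≤m : t ≤ m
  t≤m = ≤-trans (≤-trans (m≤m*n t (suc k)) (m≤n*m _ R)) Rt≤m

  N+t≡m : N + t ≡ m
  N+t≡m = m∸n+n≡m t≤m

  -- Multiplying by `m` turns `m * z` into `suc k * c` by absorption, which avoids a division.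
  core : R * c ≤ R * y + c
  core = *-cancelˡ-≤ m (begin
    m * (R * c)                          ≤⟨ *-monoʳ-≤ m (*-monoʳ-≤ R (≤-trans (≤-reflexive (cong (_C suc k) (sym N+t≡m)))
                                              (C-+-upper k N t (≤-reflexive N+t≡m)))) ⟩
    m * (R * (y + t * z))                ≡⟨ rearrange₄ m R y t z ⟩
    m * (R * y) + R * t * (m * z)        ≡⟨ cong (λ w → m * (R * y) + R * t * w) (C-absorption m′ k) ⟨
    m * (R * y) + R * t * (suc k * c)    ≡⟨ rearrange₅ m R y t k c ⟩
    m * (R * y) + R * (t * suc k) * c    ≤⟨ +-monoʳ-≤ (m * (R * y)) (*-monoˡ-≤ c Rt≤m) ⟩
    m * (R * y) + m * c                  ≡⟨ *-distribˡ-+ m (R * y) c ⟨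
    m * (R * y + c)                      ∎)

  gap : suc t * y ≤ oreGap (2 + m) (2 + k) (2 + t)
  gap = m+n≤o⇒m≤o∸n (suc t * y) (begin
    suc t * y + N C (2 + k)      ≡⟨ +-comm (suc t * y) _ ⟩
    N C (2 + k) + suc t * y      ≤⟨ C-+-lower (suc k) N (suc t) ⟩
    (N + suc t) C (2 + k)        ≡⟨ cong (_C (2 + k)) (trans (+-suc N t) (cong suc N+t≡m)) ⟩
    suc m C (2 + k)              ∎)

-- s times the left-hand side bounds the sum of the degrees over s disjoint edges of size 2 + k, if at most s of their
-- vertices have degree above s (2a + 1) and those have degree at most s (2a + 1) + s k a.
linkCount : ∀ k s m {a} → a ≡ m C k → 3 * ((2 + k) * (2 + k)) * suc s ≤ 2 + m →
  (2 + k) * (s * (2 * a + 1)) + s * (k * a) ≤ suc m C suc k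
-- The factor `suc k` lets absorption replace `suc m C suc k` by `suc m * a`. After `K≤2a` has
-- absorbed the summand without `a`, a polynomial inequality remains.
linkCount k s m {a} refl large = *-cancelˡ-≤ (suc k) (begin
  suc k * ((2 + k) * (s * (2 * a + 1)) + s * (k * a))                   ≡⟨ rearrange₁ k s a ⟩
  s * (suc k * ((4 + 3 * k) * a + (2 + k)))                             ≤⟨ *-monoʳ-≤ s (*-monoʳ-≤ (suc k) (+-monoʳ-≤ _ K≤2a)) ⟩
  s * (suc k * ((4 + 3 * k) * a + 2 * a))                               ≡⟨ rearrange₂ k s a ⟩
  s * (suc k * (6 + 3 * k)) * a                                         ≤⟨ *-monoˡ-≤ a small ⟩
  suc m * a                                                             ≡⟨ C-absorption m k ⟨
  suc k * (suc m C suc k)                                               ∎)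
  where
  open ≤-Reasoning
  rearrange₁ : ∀ k s a → (1 + k) * ((2 + k) * (s * (2 * a + 1)) + s * (k * a)) ≡ s * ((1 + k) * ((4 + 3 * k) * a + (2 + k)))
  rearrange₁ = solve-∀
  rearrange₂ : ∀ k s a → s * ((1 + k) * ((4 + 3 * k) * a + 2 * a)) ≡ s * ((1 + k) * (6 + 3 * k)) * a
  rearrange₂ = solve-∀
  rearrange₃ : ∀ k s → s * ((1 + k) * (6 + 3 * k)) + (3 * ((2 + k) * s) + (12 + 12 * k + 3 * (k * k))) ≡ 3 * ((2 + k) * (2 + k)) * (1 + s)
  rearrange₃ = solve-∀
  rearrange₄ : ∀ k → 12 + 12 * k + 3 * (k * k) ≡ (4 + 2 * k) + (8 + 10 * k + 3 * (k * k))
  rearrange₄ = solve-∀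

  small : s * (suc k * (6 + 3 * k)) ≤ suc m
  small = s≤s⁻¹ (begin
    1 + s * (suc k * (6 + 3 * k))   ≡⟨ +-comm 1 _ ⟩
    s * (suc k * (6 + 3 * k)) + 1   ≤⟨ +-monoʳ-≤ _ (≤-trans (s≤s z≤n) (m≤n+m (12 + 12 * k + 3 * (k * k)) (3 * ((2 + k) * s)))) ⟩
    s * (suc k * (6 + 3 * k)) + (3 * ((2 + k) * s) + (12 + 12 * k + 3 * (k * k))) ≡⟨ rearrange₃ k s ⟩
    3 * ((2 + k) * (2 + k)) * suc s ≤⟨ large ⟩
    2 + m                           ∎)

  2k≤m : 4 + 2 * k ≤ 2 + m
  2k≤m = begin
    4 + 2 * k                                   ≤⟨ m≤m+n _ _ ⟩
    (4 + 2 * k) + (8 + 10 * k + 3 * (k * k))    ≡⟨ rearrange₄ k ⟨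
    12 + 12 * k + 3 * (k * k)                   ≤⟨ ≤-trans (m≤n+m _ _) (m≤n+m _ (s * (suc k * (6 + 3 * k)))) ⟩
    s * (suc k * (6 + 3 * k)) + (3 * ((2 + k) * s) + (12 + 12 * k + 3 * (k * k))) ≡⟨ rearrange₃ k s ⟩
    3 * ((2 + k) * (2 + k)) * suc s             ≤⟨ large ⟩
    2 + m                                       ∎

  -- For `k = 0` the coefficient is 1 and equality holds, hence the factor 2. Otherwise
  -- `C(m, k) ≥ m - k + 1` by `n<C+k`.
  K≤2C : ∀ k → 4 + 2 * k ≤ 2 + m → 2 + k ≤ 2 * (m C k)
  K≤2C zero    _  = ≤-refl
  K≤2C (suc k) 2k≤m = begin
    3 + k                      ≤⟨ +-cancelʳ-≤ (suc k) (3 + k) _ (begin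
      3 + k + suc k              ≡⟨ rearrange k ⟩
      4 + 2 * k                  ≤⟨ s≤s⁻¹ (s≤s⁻¹ (≤-trans (≤-reflexive (rearrange′ k)) 2k≤m)) ⟩
      m                          ≤⟨ n≤1+n m ⟩
      suc m                      ≤⟨ n<C+k {m} {k} (≤-trans (s≤s (≤-trans (m≤n+m k 3) (m≤m+n _ _))) (s≤s⁻¹ (s≤s⁻¹ (≤-trans (≤-reflexive (rearrange″ k)) 2k≤m)))) ⟩
      m C suc k + suc k          ∎) ⟩
    m C suc k                  ≤⟨ m≤n*m _ 2 ⟩
    2 * (m C suc k)            ∎
    where
    rearrange : ∀ k → 3 + k + (1 + k) ≡ 4 + 2 * k
    rearrange = solve-∀
    rearrange′ : ∀ k → 2 + (4 + 2 * k) ≡ 4 + 2 * (1 + k)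
    rearrange′ = solve-∀
    rearrange″ : ∀ k → 2 + (1 + (3 + k + k)) ≡ 4 + 2 * (1 + k)
    rearrange″ = solve-∀

  K≤2a : 2 + k ≤ 2 * a
  K≤2a = K≤2C k 2k≤m

private
  -- `P` bounds `U - L` from below, so the last inequality gives `P * suc D ≤ B + M * s`. With
  -- `R = 3 * (3 + k)`, the lower bound on `D` makes `R` times the left side at least
  -- `P * (R - 1) * s * c + P * R`. The right side is at most
  -- `s * c * (s * (2 + k) * (7 + 3 * k) + 2)`, and `P` is assumed large enough for the first term
  -- alone to match `R` times this. The excess `P * R`, due to the successor in `suc D`, is the
  -- contradiction.
  oreCount-core : ∀ k s {M U L D c} P →
    M ≡ P + (2 + k + s + s * (3 + k)) → s * ((2 + k) * (3 + k)) + 2 * (2 + k) ≤ M →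
    3 * (3 + k) * (s * ((2 + k) * (7 + 3 * k)) + 2) + P ≤ P * (3 * (3 + k)) → 1 ≤ P →
    M ≤ U + s * (3 + k) → U ≤ M → L ≤ 2 + k + s → M ≤ c + (2 + k) →
    3 * (3 + k) * (s * c) ≤ 3 * (3 + k) * D + s * c →
    U * suc D ≤ (2 + k) * (s * (3 + k) * (s * (2 * c + 1)) + s * (s * ((1 + k) * c))) + U * s + L * suc D → ⊥
  oreCount-core k s {M} {U} {L} {D} {c} P M≡ W≤M P≤PR 1≤P M≤U+W U≤M L≤ M≤c+ D-lower total =
    contradiction (+-cancelˡ-≤ (P * (R * (s * c))) (P * R) 0 (begin
    P * (R * (s * c)) + P * R             ≡⟨ *-distribˡ-+ P (R * (s * c)) R ⟨
    P * (R * (s * c) + R)                 ≤⟨ *-monoʳ-≤ P (+-monoˡ-≤ R D-lower) ⟩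
    P * (R * D + s * c + R)               ≡⟨ rearrange₁ P R D s c ⟩
    R * (P * suc D) + P * (s * c)         ≤⟨ +-monoˡ-≤ _ (*-monoʳ-≤ R PX≤) ⟩
    R * (B + M * s) + P * (s * c)         ≡⟨ rearrange₂ k s M P c ⟩
    s * (R * (s * ((2 + k) * (7 + 3 * k)) * c + (s * ((2 + k) * (3 + k)) + M)) + P * c)
                                          ≤⟨ *-monoʳ-≤ s (+-monoˡ-≤ (P * c) (*-monoʳ-≤ R (+-monoʳ-≤ (s * ((2 + k) * (7 + 3 * k)) * c) W+M≤2c))) ⟩
    s * (R * (s * ((2 + k) * (7 + 3 * k)) * c + 2 * c) + P * c)
                                          ≡⟨ rearrange₃ R s _ P c ⟩
    (R * (s * ((2 + k) * (7 + 3 * k)) + 2) + P) * (s * c)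
                                          ≤⟨ *-monoˡ-≤ (s * c) P≤PR ⟩
    P * R * (s * c)                       ≡⟨ trans (*-assoc P R (s * c)) (sym (+-identityʳ _)) ⟩
    P * (R * (s * c)) + 0                 ∎)) (<⇒≱ (*-mono-≤ 1≤P (s≤s z≤n)))
    where
    open ≤-Reasoning
    R = 3 * (3 + k)
    B = (2 + k) * (s * (3 + k) * (s * (2 * c + 1)) + s * (s * ((1 + k) * c)))
    rearrange₁ : ∀ P R D s c → P * (R * D + s * c + R) ≡ R * (P * (1 + D)) + P * (s * c)
    rearrange₁ = solve-∀
    rearrange₂ : ∀ k s M P c →
      3 * (3 + k) * ((2 + k) * (s * (3 + k) * (s * (2 * c + 1)) + s * (s * ((1 + k) * c))) + M * s) + P * (s * c) ≡
      s * (3 * (3 + k) * (s * ((2 + k) * (7 + 3 * k)) * c + (s * ((2 + k) * (3 + k)) + M)) + P * c)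
    rearrange₂ = solve-∀
    rearrange₃ : ∀ R s t P c → s * (R * (s * t * c + 2 * c) + P * c) ≡ (R * (s * t + 2) + P) * (s * c)
    rearrange₃ = solve-∀
    rearrange₄ : ∀ k s U L X B → B + U * s + L * X + s * (3 + k) * X ≡ B + U * s + (L + s * (3 + k)) * X
    rearrange₄ = solve-∀

    PX≤ : P * suc D ≤ B + M * s
    PX≤ = +-cancelʳ-≤ ((2 + k + s + s * (3 + k)) * suc D) _ _ (begin
      P * suc D + (2 + k + s + s * (3 + k)) * suc D       ≡⟨ *-distribʳ-+ (suc D) P _ ⟨
      (P + (2 + k + s + s * (3 + k))) * suc D             ≡⟨ cong (_* suc D) M≡ ⟨
      M * suc D                                           ≤⟨ *-monoˡ-≤ (suc D) M≤U+W ⟩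
      (U + s * (3 + k)) * suc D                           ≡⟨ *-distribʳ-+ (suc D) U _ ⟩
      U * suc D + s * (3 + k) * suc D                     ≤⟨ +-monoˡ-≤ _ total ⟩
      B + U * s + L * suc D + s * (3 + k) * suc D         ≡⟨ rearrange₄ k s U L (suc D) B ⟩
      B + U * s + (L + s * (3 + k)) * suc D               ≤⟨ +-mono-≤ (+-monoʳ-≤ B (*-monoˡ-≤ s U≤M)) (*-monoˡ-≤ (suc D) (+-monoˡ-≤ _ L≤)) ⟩
      B + M * s + (2 + k + s + s * (3 + k)) * suc D       ∎)

    -- The terms of lower order cost at most `2 * c`, because `c` is at least `M - (2 + k)` and
    -- `W≤M` leaves room for twice that deficit.
    W+M≤2c : s * ((2 + k) * (3 + k)) + M ≤ 2 * c
    W+M≤2c = +-cancelʳ-≤ (2 * (2 + k)) _ _ (begin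
      s * ((2 + k) * (3 + k)) + M + 2 * (2 + k)    ≡⟨ rearrange₆ (s * ((2 + k) * (3 + k))) M (2 * (2 + k)) ⟩
      (s * ((2 + k) * (3 + k)) + 2 * (2 + k)) + M  ≤⟨ +-monoˡ-≤ M W≤M ⟩
      M + M                                        ≡⟨ cong (M +_) (+-identityʳ M) ⟨
      2 * M                                        ≤⟨ *-monoʳ-≤ 2 M≤c+ ⟩
      2 * (c + (2 + k))                            ≡⟨ *-distribˡ-+ 2 c (2 + k) ⟩
      2 * c + 2 * (2 + k)                          ∎)
      where
      rearrange₆ : ∀ a b d → a + b + d ≡ a + d + b
      rearrange₆ = solve-∀

-- M counts all vertices, U those outside the matching, L those of degree at most D among the latter, and c bounds the
-- codegrees. The argument P of oreCount-core is M ∸ (2 + k + s + s * (3 + k)), expanded for M = 3 (3 + k)² (1 + s) + 1 + q.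
oreCount : ∀ k s {M U L D c} →
  3 * ((3 + k) * (3 + k)) * suc s < M → M ≤ U + s * (3 + k) → U ≤ M → L ≤ 2 + k + s → M ≤ c + (2 + k) →
  3 * (3 + k) * (s * c) ≤ 3 * (3 + k) * D + s * c →
  U * suc D ≤ (2 + k) * (s * (3 + k) * (s * (2 * c + 1)) + s * (s * ((1 + k) * c))) + U * s + L * suc D → ⊥
oreCount k s {M} large with m≤n⇒∃[o]m+o≡n large
... | q , M≡q = oreCount-core k s (1 + (25 + s * (3 * (k * k) + 17 * k + 23) + 3 * (k * k) + 17 * k + q))
  (trans (sym M≡q) (M≡ k s q)) (≤-trans (m≤m+n _ _) (≤-reflexive (trans (M≡′ k s q) M≡q)))
  (≤-trans (m≤m+n _ _) (≤-reflexive (PR-split k s q))) (s≤s z≤n)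
  where
  M≡ : ∀ k s q → suc (3 * ((3 + k) * (3 + k)) * (1 + s)) + q ≡
    (1 + (25 + s * (3 * (k * k) + 17 * k + 23) + 3 * (k * k) + 17 * k + q)) + (2 + k + s + s * (3 + k))
  M≡ = solve-∀
  -- Here and in `PR-split` the inequality is certified by writing the difference of its sides as a
  -- polynomial with natural coefficients.
  M≡′ : ∀ k s q → (s * ((2 + k) * (3 + k)) + 2 * (2 + k)) + ((3 * (k * k) + 16 * k + 24) + s * ((3 + k) * (7 + 2 * k)) + q) ≡
    suc (3 * ((3 + k) * (3 + k)) * (1 + s)) + q
  M≡′ = solve-∀
  PR-split : ∀ k s q →
    (3 * (3 + k) * (s * ((2 + k) * (7 + 3 * k)) + 2) + (1 + (25 + s * (3 * (k * k) + 17 * k + 23) + 3 * (k * k) + 17 * k + q)))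
    + (s * (9 * (k * k) + 46 * k + 58) + (9 * (k * (k * k)) + 75 * (k * k) + 208 * k + 190) + q * (8 + 3 * k)) ≡
    (1 + (25 + s * (3 * (k * k) + 17 * k + 23) + 3 * (k * k) + 17 * k + q)) * (3 * (3 + k))
  PR-split = solve-∀

-- Uniform families with many edges and injective colourings

heavy : Family n → ℕ → List (Fin n)
heavy F t = filter (λ v → t <? deg F v) (allFin _)

-- There are at most `s * k` covered vertices, and at most `s` of them can be heavy and cost the
-- extra `d`.
sum-deg-covered : {F : Family n} (ys : Fin s → Subset n × ℕ) (t d : ℕ) → (∀ j → ∣ proj₁ (ys j) ∣ ≡ k) →
  (∀ v → deg F v ≤ t + d) → length (heavy F t) ≤ s → sum (map (deg F) (covered ys)) ≤ s * k * t + s * d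
sum-deg-covered {s = s} {k} {F} ys t d sizes deg≤ few = begin
  sum (map (deg F) (covered ys))
    ≤⟨ sum-map-two-level (λ v → t <? deg F v) (deg F) t d (covered ys) (λ {v} _ → deg≤ v) ≮⇒≥ ⟩
  length (covered ys) * t + length (filter (λ v → t <? deg F v) (covered ys)) * d
    ≤⟨ +-mono-≤ (*-monoˡ-≤ t (length-covered ys sizes)) (*-monoˡ-≤ d (≤-trans fewCovered few)) ⟩
  s * k * t + s * d ∎
  where
  open ≤-Reasoning
  fewCovered : length (filter (λ v → t <? deg F v) (covered ys)) ≤ length (heavy F t)
  fewCovered = Unique⊆⇒length≤ (Unique.filter⁺ (λ v → t <? deg F v) (covered-unique ys))
    (λ v∈ → ∈-filter⁺ (λ v → t <? deg F v) (∈-allFin _) (proj₂ (∈-filter⁻ (λ v → t <? deg F v) {xs = covered ys} v∈)))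

-- Edges have `suc k` vertices and `m C k` is the maximal possible degree `b`. For positive `s` the
-- last condition asks for more than `(s - 1) * (b + 1)` edges; adding `b` on the right avoids
-- truncated subtraction. The vertex sets `A i` may differ because the links of different vertices
-- live on different sets.
UniformRainbow : (k s m : ℕ) → Set
UniformRainbow k s m = ∀ {n} (A : Fin s → Subset n) (F : Fin s → Family n) → (∀ i → ∣ A i ∣ ≡ suc m) →
  (∀ i → Uniform (A i) (suc k) (F i)) → (∀ i → Unique (colours (F i))) →
  3 * ((1 + k) * (1 + k)) * s ≤ suc m → (∀ i → s * (m C k + 1) ≤ length (F i) + m C k) → Rainbow F

-- Shared by both inductions, hence injectivity of colours is asked only on links. The distinct
-- heavy vertices come from `distinctRepresentatives`.
rainbowFromHeavy : UniformRainbow k (suc s) m → (A : Fin (suc s) → Subset n) (F : Fin (suc s) → Family n) →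
  (∀ i → ∣ A i ∣ ≡ 2 + m) → (∀ i → Uniform (A i) (2 + k) (F i)) → (∀ i v → Unique (colours (link v (F i)))) →
  3 * ((1 + k) * (1 + k)) * suc s ≤ suc m → (∀ i → s < length (heavy (F i) (s * (2 * (m C k) + 1)))) → Rainbow F
rainbowFromHeavy {k} {s} {m} {n} linkRainbow A F ∣A∣ U uniq large many
  with distinctRepresentatives _≟_ (λ i → heavy (F i) t) (λ i → Unique.filter⁺ _ (Unique.allFin⁺ n)) many
  where t = s * (2 * (m C k) + 1)
... | v , v∈ , v-inj = Rainbow-links F v v-inj
  (linkRainbow (λ i → A i - v i) G
    (λ i → suc-injective (trans (suc∣p-x∣≡∣p∣ (vᵢ∈Aᵢ i)) (∣A∣ i)))
    (λ i → Uniform-filter _ (Uniform-link (v i) (U i)))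
    (λ i → Unique-map-filter _ (uniq i (v i)))
    large G-large)
  where
  open ≤-Reasoning
  a = m C k
  t = s * (2 * a + 1)
  W : Fin (suc s) → List (Fin n)
  W i = tabulate (removeAt v i)
  G : Fin (suc s) → Family n
  G i = avoiding (W i) (link (v i) (F i))
  vᵢ-heavy : ∀ i → t < deg (F i) (v i)
  vᵢ-heavy i = proj₂ (∈-filter⁻ (λ v → t <? deg (F i) v) {xs = allFin n} (v∈ i))
  vᵢ∈Aᵢ : ∀ i → v i ∈ˢ A i
  vᵢ∈Aᵢ i with 0<deg⇒∈ {F = F i} (v i) (≤-trans (s≤s z≤n) (vᵢ-heavy i))
  ... | (e , c) , ec∈ , v∈e = within (U i) ec∈ v∈e
  rearrange₁ : ∀ s a → (1 + s) * (a + 1) + s * a ≡ (1 + s * (2 * a + 1)) + a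
  rearrange₁ = solve-∀
  rearrange₂ : ∀ x g a → x + g + a ≡ g + a + x
  rearrange₂ = solve-∀
  -- Origin of the threshold `t`: avoiding the other `s` chosen vertices costs at most `s * a` link
  -- edges, and more than `t - s * a = s * (a + 1)` edges remain.
  G-large : ∀ i → suc s * (a + 1) ≤ length (G i) + a
  G-large i = +-cancelʳ-≤ (s * a) _ _ (begin
    suc s * (a + 1) + s * a                                      ≡⟨ rearrange₁ s a ⟩
    suc t + a                                                    ≤⟨ +-monoˡ-≤ a (vᵢ-heavy i) ⟩
    deg (F i) (v i) + a                                          ≡⟨ cong (_+ a) (length-link (v i) (F i)) ⟨
    length (link (v i) (F i)) + a                                ≤⟨ +-monoˡ-≤ a (length-avoiding (W i) (link (v i) (F i))) ⟩
    sum (map (deg (link (v i) (F i))) (W i)) + length (G i) + a  ≤⟨ +-monoˡ-≤ a (+-monoˡ-≤ (length (G i))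
                                                                      (sum-map≤length* (W i) (λ {w} _ → codeg≤C (∣A∣ i) (U i) (v i) w))) ⟩
    length (W i) * a + length (G i) + a                          ≡⟨ cong (λ l → l * a + length (G i) + a) (length-tabulate (removeAt v i)) ⟩
    s * a + length (G i) + a                                     ≡⟨ rearrange₂ (s * a) _ a ⟩
    length (G i) + a + s * a                                     ∎)

link-colours : (v : Fin n) (F : Family n) → Unique (colours F) → Unique (colours (link v F))
link-colours v F u = subst Unique (map-∘ (filter (λ x → v ∈? proj₁ x) F)) (Unique-map-filter (λ x → v ∈? proj₁ x) u)

-- If no vertex exceeds the threshold of `Rainbow-extend`, all degrees are at most `t + d` as
-- `sum-deg-covered` requires.
heavy-threshold : ∀ k s a → s * ((2 + k) * a + 1) ≡ s * (2 * a + 1) + s * (k * a)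
heavy-threshold = solve-∀

-- The recursion lowers `s` when a single edge is added to a matching, and lowers `k`, along with
-- the number of vertices, when it passes to links.
uniformRainbow : ∀ k s m → UniformRainbow k s m
uniformRainbow k zero m A F _ _ _ _ _ = (λ ()) , (λ ()) , λ ()
-- Edges are singletons and degrees are at most 1, so `s` covered vertices and `s` colours spoil at
-- most `2 * s` edges, one fewer than `long` provides.
uniformRainbow zero (suc s) m A F ∣A∣ U uniq large long
  with R@(ys , ys∈ , _) ← uniformRainbow zero s m (removeAt A zero) (removeAt F zero) (∣A∣ ∘ suc) (U ∘ suc) (uniq ∘ suc)
         (≤-trans (*-monoʳ-≤ 3 (n≤1+n s)) large)
         (λ i → ≤-trans (*-monoˡ-≤ 2 (n≤1+n s)) (long (suc i)))
  with compatibleEdge? (F zero) ys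
... | yes (x , x∈ , compat) = Rainbow-insert F zero R x∈ compat
... | no none = contradiction (begin
  suc s * 2                                          ≤⟨ long zero ⟩
  length (F zero) + 1                                ≤⟨ +-monoˡ-≤ 1 (conflicts-bound ys (uniq zero) none) ⟩
  sum (map (deg (F zero)) (covered ys)) + s + 1      ≤⟨ +-monoˡ-≤ 1 (+-monoˡ-≤ s (sum-map≤length* (covered ys) (λ {w} _ → deg≤C (∣A∣ zero) (U zero) w))) ⟩
  length (covered ys) * 1 + s + 1                    ≤⟨ +-monoˡ-≤ 1 (+-monoˡ-≤ s (*-monoˡ-≤ 1 (length-covered ys (λ j → size (U (suc j)) (ys∈ j))))) ⟩
  s * 1 * 1 + s + 1                                  ≡⟨ rearrange s ⟩
  s * 2 + 1                                          ∎) (<⇒≱ (≤-reflexive (cong suc (+-comm (s * 2) 1))))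
  where
  open ≤-Reasoning
  rearrange : ∀ s → s * 1 * 1 + s + 1 ≡ s * 2 + 1
  rearrange = solve-∀
uniformRainbow (suc k) (suc s) zero A F ∣A∣ U uniq large long = contradiction large
  (<⇒≱ (*-mono-≤ {2} {3 * ((2 + k) * (2 + k))} (s≤s (s≤s z≤n)) (s≤s (z≤n {s}))))
uniformRainbow (suc k) (suc s) (suc m) {n} A F ∣A∣ U uniq large long
  with any? (λ i → any? (λ v → s * ((2 + k) * (m C k) + 1) <? deg (F i) v))
     | any? (λ i → length (heavy (F i) (s * (2 * (m C k) + 1))) ≤? s)
-- The sets `A` stay unchanged. Deleting `v` costs another family at most `b` edges, which is
-- covered by the weaker demand for `s` families.
... | yes (i , v , Δ<deg) | _ =
  Rainbow-extend F i v (λ j → size (U j)) (codeg≤C (∣A∣ i) (U i) v) (link-colours v (F i) (uniq i)) Δ<deg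
    (uniformRainbow (suc k) s (suc m) (removeAt A i) F′ (∣A∣ ∘ punchIn i) (λ j → Uniform-filter _ (U (punchIn i j)))
      (λ j → Unique-map-filter _ (uniq (punchIn i j)))
      (≤-trans (*-monoʳ-≤ (3 * ((2 + k) * (2 + k))) (n≤1+n s)) large) F′-long)
  where
  open ≤-Reasoning
  b = suc m C suc k
  F′ : Fin s → Family n
  F′ j = avoiding (v ∷ []) (F (punchIn i j))
  rearrange : ∀ b l → b + 0 + l + b ≡ b + (l + b)
  rearrange = solve-∀
  F′-long : ∀ j → s * (b + 1) ≤ length (F′ j) + b
  F′-long j = ≤-trans (n≤1+n _) (+-cancelˡ-≤ b _ _ (begin
    b + suc (s * (b + 1))                                ≡⟨ +-suc b _ ⟩
    suc b + s * (b + 1)                                  ≡⟨ cong (_+ s * (b + 1)) (+-comm 1 b) ⟩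
    suc s * (b + 1)                                      ≤⟨ long (punchIn i j) ⟩
    length (F (punchIn i j)) + b                         ≤⟨ +-monoˡ-≤ b (length-avoiding (v ∷ []) (F (punchIn i j))) ⟩
    deg (F (punchIn i j)) v + 0 + length (F′ j) + b      ≤⟨ +-monoˡ-≤ b (+-monoˡ-≤ (length (F′ j)) (+-monoˡ-≤ 0 (deg≤C (∣A∣ (punchIn i j)) (U (punchIn i j)) v))) ⟩
    b + 0 + length (F′ j) + b                            ≡⟨ rearrange b (length (F′ j)) ⟩
    b + (length (F′ j) + b)                              ∎))
... | no noHeavier | yes (i , few)
  with R@(ys , ys∈ , _) ← uniformRainbow (suc k) s (suc m) (removeAt A i) (removeAt F i) (∣A∣ ∘ punchIn i) (U ∘ punchIn i)
         (uniq ∘ punchIn i) (≤-trans (*-monoʳ-≤ (3 * ((2 + k) * (2 + k))) (n≤1+n s)) large)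
         (λ j → ≤-trans (*-monoˡ-≤ (suc m C suc k + 1) (n≤1+n s)) (long (punchIn i j)))
  with compatibleEdge? (F i) ys
... | yes (x , x∈ , compat) = Rainbow-insert F i R x∈ compat
-- By `linkCount` the covered vertices spoil at most `s * b` edges. With the `s` colours this is one
-- edge fewer than `long` provides.
... | no none = contradiction (+-cancelʳ-≤ b _ _ (begin
  suc (s * (b + 1)) + b                                 ≡⟨ rearrange₁ s b ⟩
  suc s * (b + 1)                                       ≤⟨ long i ⟩
  length (F i) + b                                      ≤⟨ +-monoˡ-≤ b (conflicts-bound ys (uniq i) none) ⟩
  sum (map (deg (F i)) (covered ys)) + s + b            ≤⟨ +-monoˡ-≤ b (+-monoˡ-≤ s (sum-deg-covered {F = F i} ys t d (λ j → size (U (punchIn i j)) (ys∈ j)) deg≤ few)) ⟩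
  s * (2 + k) * t + s * d + s + b                       ≡⟨ rearrange₂ s (2 + k) t d b ⟩
  s * ((2 + k) * t + d) + s + b                         ≤⟨ +-monoˡ-≤ b (+-monoˡ-≤ s (*-monoʳ-≤ s (linkCount k s m refl large))) ⟩
  s * b + s + b                                         ≡⟨ rearrange₃ s b ⟩
  s * (b + 1) + b                                       ∎)) (<⇒≱ ≤-refl)
  where
  open ≤-Reasoning
  b = suc m C suc k
  t = s * (2 * (m C k) + 1)
  d = s * (k * (m C k))
  deg≤ : ∀ v → deg (F i) v ≤ t + d
  deg≤ v = ≤-trans (≮⇒≥ (λ Δ<deg → noHeavier (i , v , Δ<deg))) (≤-reflexive (heavy-threshold k s (m C k)))
  rearrange₁ : ∀ s b → 1 + s * (b + 1) + b ≡ (1 + s) * (b + 1)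
  rearrange₁ = solve-∀
  rearrange₂ : ∀ s k t d b → s * k * t + s * d + s + b ≡ s * (k * t + d) + s + b
  rearrange₂ = solve-∀
  rearrange₃ : ∀ s b → s * b + s + b ≡ s * (b + 1) + b
  rearrange₃ = solve-∀
uniformRainbow (suc k) (suc s) (suc m) A F ∣A∣ U uniq large long | no _ | no notFew =
  rainbowFromHeavy (uniformRainbow k (suc s) m) A F ∣A∣ U (λ i v → link-colours v (F i) (uniq i)) large′
    (λ i → ≰⇒> (λ few → notFew (i , few)))
  where
  open ≤-Reasoning
  split : ∀ k s → 3 * ((1 + k) * (1 + k)) * (1 + s) + 1 + (8 + 6 * k + 9 * s + 6 * k * s) ≡ 3 * ((2 + k) * (2 + k)) * (1 + s)
  split = solve-∀
  large′ : 3 * ((1 + k) * (1 + k)) * suc s ≤ suc m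
  large′ = s≤s⁻¹ (begin
    suc (3 * ((1 + k) * (1 + k)) * suc s)   ≡⟨ +-comm 1 _ ⟩
    3 * ((1 + k) * (1 + k)) * suc s + 1     ≤⟨ m≤m+n _ _ ⟩
    3 * ((1 + k) * (1 + k)) * suc s + 1 + (8 + 6 * k + 9 * s + 6 * k * s) ≡⟨ split k s ⟩
    3 * ((2 + k) * (2 + k)) * suc s         ≤⟨ large ⟩
    2 + m                                   ∎)

-- Families with an Ore condition

fromList : List (Fin n) → Subset n
fromList []       = ∅
fromList (x ∷ xs) = ⁅ x ⁆ ∪ fromList xs

∈-fromList⁺ : {x : Fin n} {xs : List (Fin n)} → x ∈ xs → x ∈ˢ fromList xs
∈-fromList⁺ {xs = y ∷ xs} (here refl) = x∈p∪q⁺ (inj₁ (x∈⁅x⁆ y))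
∈-fromList⁺ {xs = y ∷ xs} (there x∈)  = x∈p∪q⁺ {p = ⁅ y ⁆} (inj₂ (∈-fromList⁺ x∈))

∈-fromList⁻ : {x : Fin n} (xs : List (Fin n)) → x ∈ˢ fromList xs → x ∈ xs
∈-fromList⁻ []       x∈ = contradiction x∈ ∉⊥
∈-fromList⁻ (y ∷ xs) x∈ with x∈p∪q⁻ ⁅ y ⁆ (fromList xs) x∈
... | inj₁ x∈y  = here (x∈⁅y⁆⇒x≡y y x∈y)
... | inj₂ x∈xs = there (∈-fromList⁻ xs x∈xs)

∣fromList∣ : {xs : List (Fin n)} → Unique xs → ∣ fromList xs ∣ ≡ length xs
∣fromList∣ {xs = xs} u = trans (sym (length-elements (fromList xs))) (≤-antisym
  (Unique⊆⇒length≤ (elements-unique (fromList xs)) (λ x∈ → ∈-fromList⁻ xs (∈-elements⁻ x∈)))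
  (Unique⊆⇒length≤ u (λ x∈ → ∈-elements⁺ (∈-fromList⁺ x∈))))

ProperlyColoured : Family n → Set
ProperlyColoured F = ∀ {x y v} → x ∈ F → y ∈ F → v ∈ˢ proj₁ x → v ∈ˢ proj₁ y → proj₂ x ≡ proj₂ y → proj₁ x ≡ proj₁ y

ProperlyColoured-⊆ : {F G : Family n} → (∀ {x} → x ∈ F → x ∈ G) → ProperlyColoured G → ProperlyColoured F
ProperlyColoured-⊆ F⊆G proper x∈ y∈ = proper (F⊆G x∈) (F⊆G y∈)

link-colours-proper : {A : Subset n} {F : Family n} → Uniform A k F → ProperlyColoured F → ∀ v → Unique (colours (link v F))
link-colours-proper {F = F} U proper v = subst Unique (map-∘ (filter (λ x → v ∈? proj₁ x) F))
  (Unique-map-coarser (Unique-map-filter (λ x → v ∈? proj₁ x) (distinct U)) same)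
  where
  same : ∀ {x y} → x ∈ filter (λ x → v ∈? proj₁ x) F → y ∈ filter (λ x → v ∈? proj₁ x) F → proj₂ x ≡ proj₂ y → proj₁ x ≡ proj₁ y
  same x∈ y∈ with ∈-filter⁻ (λ x → v ∈? proj₁ x) {xs = F} x∈ | ∈-filter⁻ (λ x → v ∈? proj₁ x) {xs = F} y∈
  ... | x∈F , v∈x | y∈F , v∈y = proper x∈F y∈F v∈x v∈y

-- The factor `r` is kept apart from `b`, so that lowering every degree by `c` lowers `b` by `c`.
-- Only subsets of the current vertex set `A` are tested.
OreCondition : Subset n → ℕ → ℕ → Family n → Set
OreCondition A r b F = ∀ S → S ⊆ A → ∣ S ∣ ≡ r → S ∉ edges F → r * b < sum (map (deg F) (elements S))

deg≤codeg+deg-avoiding : (F : Family n) {u v : Fin n} → u ≢ v → deg F u ≤ deg (link u F) v + deg (avoiding (v ∷ []) F) u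
deg≤codeg+deg-avoiding F {u} {v} u≢v = begin
  deg F u                                                                    ≡⟨ length-link u F ⟨
  length (link u F)                                                          ≤⟨ length-avoiding (v ∷ []) (link u F) ⟩
  deg (link u F) v + 0 + length (avoiding (v ∷ []) (link u F))               ≡⟨ cong (_+ length (avoiding (v ∷ []) (link u F))) (+-identityʳ _) ⟩
  deg (link u F) v + length (avoiding (v ∷ []) (link u F))                   ≤⟨ +-monoʳ-≤ (deg (link u F) v) commute ⟩
  deg (link u F) v + deg (avoiding (v ∷ []) F) u                             ∎
  where
  open ≤-Reasoning
  avoids? : (x : Subset _ × ℕ) → Dec (¬ Any (_∈ˢ proj₁ x) (v ∷ []))
  avoids? = ¬? ∘ touches? (v ∷ [])
  unlink : ∀ {e} → ¬ Any (_∈ˢ e - u) (v ∷ []) × u ∈ˢ e → u ∈ˢ e × ¬ Any (_∈ˢ e) (v ∷ [])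
  unlink (avoids , u∈e) = u∈e , λ { (here v∈e) → avoids (here (x∈p∧x≢y⇒x∈p-y v∈e (u≢v ∘ sym))) }
  commute : length (avoiding (v ∷ []) (link u F)) ≤ deg (avoiding (v ∷ []) F) u
  commute = begin
    length (filter avoids? (map (map₁ (_- u)) (filter (λ x → u ∈? proj₁ x) F)))
      ≡⟨ length-filter-map avoids? (map₁ (_- u)) (filter (λ x → u ∈? proj₁ x) F) ⟩
    length (filter (avoids? ∘ map₁ (_- u)) (filter (λ x → u ∈? proj₁ x) F))
      ≡⟨ length-filter-filter (avoids? ∘ map₁ (_- u)) (λ x → u ∈? proj₁ x) F ⟩
    length (filter (λ x → avoids? (map₁ (_- u) x) ×-dec (u ∈? proj₁ x)) F)
      ≤⟨ length-filter-mono _ _ (λ {x} → unlink {proj₁ x}) F ⟩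
    length (filter (λ x → (u ∈? proj₁ x) ×-dec avoids? x) F)
      ≡⟨ length-filter-filter (λ x → u ∈? proj₁ x) avoids? F ⟨
    deg (avoiding (v ∷ []) F) u ∎

-- Deleting `v` takes at most the codegree `c` from each degree, hence at most `r * c` from an
-- `r`-set. A non-edge within `A - v` was a non-edge before, since an edge without `v` survives the
-- deletion.
Ore-avoiding : {A : Subset n} {F : Family n} {r b c : ℕ} (v : Fin n) → (∀ u → deg (link u F) v ≤ c) →
  OreCondition A r (c + b) F → OreCondition (A - v) r b (avoiding (v ∷ []) F)
Ore-avoiding {A = A} {F} {r} {b} {c} v codeg≤ ore S S⊆ ∣S∣ S∉ = +-cancelˡ-< (r * c) _ _ (begin-strict
  r * c + r * b                                          ≡⟨ *-distribˡ-+ r c b ⟨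
  r * (c + b)                                            <⟨ ore S (proj₁ ∘ ∈-p-x⁻ ∘ S⊆) ∣S∣ S∉F ⟩
  sum (map (deg F) (elements S))                         ≤⟨ sum-map-mono (elements S) (λ u∈ → ≤-trans
                                                              (deg≤codeg+deg-avoiding F (proj₂ (∈-p-x⁻ {p = A} (S⊆ (∈-elements⁻ u∈)))))
                                                              (+-monoˡ-≤ _ (codeg≤ _))) ⟩
  sum (map (λ u → c + deg F′ u) (elements S))            ≡⟨ sum-map-+ (λ _ → c) (deg F′) (elements S) ⟩
  sum (map (λ _ → c) (elements S)) + D′                  ≡⟨ cong (_+ D′) (sum-map-const c (elements S)) ⟩
  length (elements S) * c + D′                           ≡⟨ cong (λ l → l * c + D′) (trans (length-elements S) ∣S∣) ⟩
  r * c + D′                                             ∎)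
  where
  open ≤-Reasoning
  F′ = avoiding (v ∷ []) F
  D′ = sum (map (deg F′) (elements S))
  S∉F : S ∉ edges F
  S∉F S∈ with ∈-map⁻ proj₁ S∈
  ... | (_ , c) , Sc∈ , refl = S∉ (∈-map⁺ proj₁ (∈-avoiding⁺ (v ∷ []) Sc∈
    (λ { (here refl) v∈S → proj₂ (∈-p-x⁻ {p = A} (S⊆ v∈S)) refl })))

-- In the subfamily of edges missing the matching, the degree sum in `link-conflicts-bound` vanishes
-- and only the `s` colours remain. The edges `fromList (y ∷ V)` lie in that subfamily, share `v`,
-- and are distinct because `y` is outside `V`.
completions-bound : {A : Subset n} {F : Family n} (ys : Fin s → Subset n × ℕ) → Uniform A k F → ProperlyColoured F →
  ¬ (∃[ x ] (x ∈ F × CompatibleWithAll ys x)) → {v : Fin n} {V Y : List (Fin n)} → v ∈ V →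
  (∀ {u} → u ∈ V → u ∉ covered ys) → (∀ {y} → y ∈ Y → y ∉ covered ys × y ∉ V) → Unique Y →
  (∀ {y} → y ∈ Y → fromList (y ∷ V) ∈ edges F) → length Y ≤ s
completions-bound {n = n} {s = s} {F = F} ys U proper none {v} {V} {Y} v∈V V∉W Y∉ Y! complete = begin
  length Y                                                        ≡⟨ length-map S Y ⟨
  length (map S Y)                                                ≤⟨ Unique⊆⇒length≤ S! S⊆ ⟩
  length (edges (filter (λ x → v ∈? proj₁ x) F′))                 ≡⟨ length-map proj₁ (filter (λ x → v ∈? proj₁ x) F′) ⟩
  deg F′ v                                                        ≤⟨ link-conflicts-bound ys v (V∉W v∈V)
                                                                       (link-colours-proper (Uniform-filter _ U) (ProperlyColoured-⊆ F′⊆F proper) v)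
                                                                       (λ { (x , x∈ , compat) → none (x , F′⊆F x∈ , compat) }) ⟩
  sum (map (deg (link v F′)) (covered ys)) + s                    ≤⟨ +-monoˡ-≤ s (sum-map≤length* (covered ys) untouched) ⟩
  length (covered ys) * 0 + s                                     ≡⟨ cong (_+ s) (*-zeroʳ (length (covered ys))) ⟩
  s                                                               ∎
  where
  open ≤-Reasoning
  F′ = avoiding (covered ys) F
  F′⊆F : ∀ {x} → x ∈ F′ → x ∈ F
  F′⊆F x∈ = proj₁ (∈-avoiding⁻ (covered ys) {F} x∈)
  S : Fin n → Subset n
  S y = fromList (y ∷ V)

  S-injective : ∀ {y z} → y ∈ Y → S y ≡ S z → y ≡ z
  S-injective {y} {z} y∈Y eq with ∈-fromList⁻ (z ∷ V) (subst (y ∈ˢ_) eq (∈-fromList⁺ {xs = y ∷ V} (here refl)))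
  ... | here y≡z  = y≡z
  ... | there y∈V = contradiction y∈V (proj₂ (Y∉ y∈Y))

  S! : Unique (map S Y)
  S! = Unique-map-coarser {f = id} (Unique.map⁺ id Y!) (λ y∈ _ → S-injective y∈)

  S-avoids : ∀ {y} → y ∈ Y → ∀ {w} → w ∈ covered ys → w ∉ˢ S y
  S-avoids {y} y∈Y w∈ w∈S with ∈-fromList⁻ (y ∷ V) w∈S
  ... | here refl = proj₁ (Y∉ y∈Y) w∈
  ... | there w∈V = V∉W w∈V w∈

  S⊆ : ∀ {e} → e ∈ map S Y → e ∈ edges (filter (λ x → v ∈? proj₁ x) F′)
  S⊆ e∈ with ∈-map⁻ S e∈
  ... | y , y∈Y , refl with ∈-map⁻ proj₁ (complete y∈Y)
  ... | (_ , c) , Sc∈ , eq = subst (_∈ edges (filter (λ x → v ∈? proj₁ x) F′)) (sym eq)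
    (∈-map⁺ proj₁ (∈-filter⁺ (λ x → v ∈? proj₁ x) (∈-avoiding⁺ (covered ys) Sc∈ (λ w∈ → subst (_ ∉ˢ_) eq (S-avoids y∈Y w∈)))
      (subst (v ∈ˢ_) eq (∈-fromList⁺ (there v∈V)))))

  untouched : ∀ {w} → w ∈ covered ys → deg (link v F′) w ≤ 0
  untouched {w} w∈ = ≮⇒≥ λ 0<d → touching (0<deg⇒∈ {F = link v F′} w 0<d)
    where
    touching : ∃[ x ] (x ∈ link v F′ × w ∈ˢ proj₁ x) → ⊥
    touching (x , x∈ , w∈x) with ∈-link⁻ v {F′} x∈
    ... | e , ec∈ , _ , refl = proj₂ (∈-avoiding⁻ (covered ys) {F} ec∈) w∈ (proj₁ (∈-p-x⁻ {p = e} w∈x))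

nonempty⇒∃ : {A : Set} {xs : List A} → 0 < length xs → ∃[ x ] x ∈ xs
nonempty⇒∃ {xs = x ∷ xs} _ = x , here refl

-- Fixing all but one vertex of an r-set of vertices of low degree, too many such vertices would give more than s edges
-- through a common vertex; they are disjoint from the matching, so each of them repeats one of the s colours of the matching.
few-low-degrees : ∀ k {A : Subset n} {F : Family n} (D : ℕ) (ys : Fin s → Subset n × ℕ) → Uniform A (2 + k) F → ProperlyColoured F →
  OreCondition A (2 + k) D F → ¬ (∃[ x ] (x ∈ F × CompatibleWithAll ys x)) →
  {L : List (Fin n)} → Unique L → (∀ {u} → u ∈ L → u ∈ˢ A × u ∉ covered ys × deg F u ≤ D) → length L ≤ 1 + k + s
few-low-degrees {n = n} {s = s} k {A} {F} D ys U proper ore none {L} L! low = ≮⇒≥ tooMany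
  where
  open ≤-Reasoning
  open import Data.List.Membership.DecPropositional (_≟_ {n}) using () renaming (_∈?_ to _∈ᶠ?_)
  open import Data.List.Membership.DecPropositional (_≟ˢ_ {n}) using () renaming (_∈?_ to _∈ᴸ?_)
  -- If `L` is too long, `V` is one vertex short of an edge, so every `S y` has `2 + k` elements.
  V = take (1 + k) L
  Y = filter (λ y → ¬? (y ∈ᶠ? V)) L
  S : Fin n → Subset n
  S y = fromList (y ∷ V)

  V-low : ∀ {u} → u ∈ V → u ∈ˢ A × u ∉ covered ys × deg F u ≤ D
  V-low = All.lookup (All.take⁺ (1 + k) (All.tabulate low))
  Y-split : ∀ {y} → y ∈ Y → y ∈ L × y ∉ V
  Y-split = ∈-filter⁻ (λ y → ¬? (y ∈ᶠ? V)) {xs = L}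
  S-low : ∀ {y u} → y ∈ Y → u ∈ˢ S y → u ∈ˢ A × u ∉ covered ys × deg F u ≤ D
  S-low {y} y∈Y u∈S with ∈-fromList⁻ (y ∷ V) u∈S
  ... | here refl = low (proj₁ (Y-split y∈Y))
  ... | there u∈V = V-low u∈V

  module _ (many : 1 + k + s < length L) where
    length-V : length V ≡ 1 + k
    length-V = trans (length-take (1 + k) L) (m≤n⇒m⊓n≡m (≤-trans (m≤m+n (1 + k) s) (<⇒≤ many)))

    s<length-Y : s < length Y
    s<length-Y = +-cancelˡ-< (1 + k) _ _ (begin-strict
      1 + k + s                                     <⟨ many ⟩
      length L                                      ≡⟨ length-filter-split (_∈ᶠ? V) L ⟩
      length (filter (_∈ᶠ? V) L) + length Y         ≤⟨ +-monoˡ-≤ (length Y) (Unique⊆⇒length≤ (Unique.filter⁺ (_∈ᶠ? V) L!)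
                                                         (λ u∈ → proj₂ (∈-filter⁻ (_∈ᶠ? V) {xs = L} u∈))) ⟩
      length V + length Y                           ≡⟨ cong (_+ length Y) length-V ⟩
      1 + k + length Y                              ∎)

    ∣S∣ : ∀ {y} → y ∈ Y → ∣ S y ∣ ≡ 2 + k
    ∣S∣ {y} y∈Y = trans (∣fromList∣ (All.tabulate (λ u∈V y≡u → proj₂ (Y-split y∈Y) (subst (_∈ V) (sym y≡u) u∈V)) ∷ Unique.take⁺ (1 + k) L!))
                       (cong suc length-V)

    tooMany : ⊥
    tooMany with Any.any? (λ y → ¬? (S y ∈ᴸ? edges F)) Y
    ... | no allEdges = <⇒≱ s<length-Y (completions-bound ys U proper none (proj₂ (nonempty⇒∃ {xs = V} (subst (0 <_) (sym length-V) z<s)))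
      (λ u∈V → proj₁ (proj₂ (V-low u∈V))) (λ y∈Y → proj₁ (proj₂ (low (proj₁ (Y-split y∈Y)))) , proj₂ (Y-split y∈Y))
      (Unique.filter⁺ _ L!) (λ {y} y∈Y → decidable-stable (S y ∈ᴸ? edges F) (λ S∉ → allEdges (lose y∈Y S∉))))
    -- A non-edge `S y` consists of vertices of degree at most `D`, so its degree sum cannot exceed
    -- `(2 + k) * D` as `ore` demands.
    ... | yes nonEdge with find nonEdge
    ... | y , y∈Y , S∉ = <⇒≱ (ore (S y) (proj₁ ∘ S-low y∈Y) (∣S∣ y∈Y) S∉) (begin
      sum (map (deg F) (elements (S y)))   ≤⟨ sum-map≤length* (elements (S y)) (λ u∈ → proj₂ (proj₂ (S-low y∈Y (∈-elements⁻ u∈)))) ⟩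
      length (elements (S y)) * D          ≡⟨ cong (_* D) (trans (length-elements (S y)) (∣S∣ y∈Y)) ⟩
      (2 + k) * D                          ∎)

-- Both gaps subtract the same coefficient, so Pascal's rule on the first one suffices. The argument
-- of type `Fin s` excludes `s = 0`, where the left side truncates to 0 and the equation can fail.
oreGap-suc : ∀ m k → Fin s → oreGap (2 + m) (suc k) (suc s) ≡ m C k + oreGap (suc m) (suc k) s
oreGap-suc {suc s} m k _ = begin
  suc m C suc k ∸ (m ∸ s) C suc k          ≡⟨ cong (_∸ (m ∸ s) C suc k) (nCk+nC[k+1]≡[n+1]C[k+1] m k) ⟨
  m C k + m C suc k ∸ (m ∸ s) C suc k      ≡⟨ +-∸-assoc (m C k) (C-monoˡ-≤ (suc k) (m∸n≤m m s)) ⟩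
  m C k + (m C suc k ∸ (m ∸ s) C suc k)    ∎
  where open ≡-Reasoning

oreGap-mono : ∀ n k s → oreGap n k s ≤ oreGap n k (suc s)
oreGap-mono n k s = ∸-monoʳ-≤ ((n ∸ 1) C k) (C-monoˡ-≤ k (∸-monoʳ-≤ n (n≤1+n s)))

OreCondition-anti : {A : Subset n} {F : Family n} {r b b′ : ℕ} → b ≤ b′ → OreCondition A r b′ F → OreCondition A r b F
OreCondition-anti {r = r} b≤b′ ore S S⊆A ∣S∣ S∉ = ≤-<-trans (*-monoʳ-≤ r b≤b′) (ore S S⊆A ∣S∣ S∉)

module _ (k : ℕ) {A : Subset n} {F : Family n} (ys : Fin s → Subset n × ℕ) (t d D : ℕ)
  (U : Uniform A (3 + k) F) (proper : ProperlyColoured F) (ore : OreCondition A (3 + k) D F)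
  (none : ¬ (∃[ x ] (x ∈ F × CompatibleWithAll ys x))) (sizes : ∀ j → ∣ proj₁ (ys j) ∣ ≡ 3 + k)
  (deg≤ : ∀ v → deg F v ≤ t + d) (few : length (heavy F t) ≤ s) where

  open ≤-Reasoning
  open import Data.List.Membership.DecPropositional (_≟_ {n}) using () renaming (_∈?_ to _∈ᶠ?_)

  private
    W = covered ys

  uncovered : List (Fin n)
  uncovered = filter (λ u → ¬? (u ∈ᶠ? W)) (elements A)

  private
    lowDegrees : List (Fin n)
    lowDegrees = filter (λ u → deg F u ≤? D) uncovered

    uncovered⁻ : ∀ {u} → u ∈ uncovered → u ∈ elements A × u ∉ W
    uncovered⁻ = ∈-filter⁻ (λ u → ¬? (u ∈ᶠ? W)) {xs = elements A}

    uncovered! : Unique uncovered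
    uncovered! = Unique.filter⁺ _ (elements-unique A)

    lowDegrees-few : length lowDegrees ≤ 2 + k + s
    lowDegrees-few = few-low-degrees (1 + k) D ys U proper ore none (Unique.filter⁺ _ uncovered!) low
      where
      low : ∀ {u} → u ∈ lowDegrees → u ∈ˢ A × u ∉ W × deg F u ≤ D
      low u∈ with ∈-filter⁻ (λ u → deg F u ≤? D) {xs = uncovered} u∈
      ... | u∈U , d≤ = ∈-elements⁻ (proj₁ (uncovered⁻ u∈U)) , proj₂ (uncovered⁻ u∈U) , d≤

    -- After exchanging the sums, a covered `w` contributes degrees in its own link, whose edges
    -- have `2 + k` vertices: at most `(2 + k) * deg F w`. The degree sum over the matching then
    -- gives the bound.
    sum-codeg : sum (map (λ u → sum (map (deg (link u F)) W)) uncovered) ≤ (2 + k) * (s * (3 + k) * t + s * d)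
    sum-codeg = begin
      sum (map (λ u → sum (map (deg (link u F)) W)) uncovered)
        ≤⟨ sum-map-mono uncovered (λ {u} _ → sum-map-mono W (λ {w} _ → codeg-sym F u w)) ⟩
      sum (map (λ u → sum (map (λ w → deg (link w F) u) W)) uncovered)
        ≡⟨ sum-swap (λ u w → deg (link w F) u) uncovered W ⟩
      sum (map (λ w → sum (map (deg (link w F)) uncovered)) W)
        ≤⟨ sum-map-mono W (λ {w} _ → ≤-trans (sum-deg (Uniform-link w U) uncovered!)
             (≤-reflexive (trans (cong (_* (2 + k)) (length-link w F)) (*-comm (deg F w) (2 + k))))) ⟩
      sum (map (λ w → (2 + k) * deg F w) W)
        ≡⟨ sum-map-* (2 + k) (deg F) W ⟩
      (2 + k) * sum (map (deg F) W)
        ≤⟨ *-monoʳ-≤ (2 + k) (sum-deg-covered {F = F} ys t d sizes deg≤ few) ⟩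
      (2 + k) * (s * (3 + k) * t + s * d) ∎

  ∣A∣≤uncovered : ∣ A ∣ ≤ length uncovered + s * (3 + k)
  ∣A∣≤uncovered = begin
    ∣ A ∣                                                       ≡⟨ length-elements A ⟨
    length (elements A)                                         ≡⟨ length-filter-split (_∈ᶠ? W) (elements A) ⟩
    length (filter (_∈ᶠ? W) (elements A)) + length uncovered    ≤⟨ +-monoˡ-≤ _ (Unique⊆⇒length≤ (Unique.filter⁺ (_∈ᶠ? W) (elements-unique A))
                                                                     (λ u∈ → proj₂ (∈-filter⁻ (_∈ᶠ? W) {xs = elements A} u∈))) ⟩
    length W + length uncovered                                 ≤⟨ +-monoˡ-≤ _ (length-covered ys sizes) ⟩
    s * (3 + k) + length uncovered                              ≡⟨ +-comm (s * (3 + k)) _ ⟩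
    length uncovered + s * (3 + k)                              ∎

  uncovered≤∣A∣ : length uncovered ≤ ∣ A ∣
  uncovered≤∣A∣ = ≤-trans (length-filter _ (elements A)) (≤-reflexive (length-elements A))

  -- Uncovered vertices of degree above `D` contribute at least `suc D` to the degree sum, the `l`
  -- others are paid for separately, and the sum itself is bounded through codegrees with the
  -- matching.
  uncovered-count : ∃[ l ] (l ≤ 2 + k + s × length uncovered * suc D ≤
    (2 + k) * (s * (3 + k) * t + s * d) + length uncovered * s + l * suc D)
  uncovered-count = length lowDegrees , lowDegrees-few , (begin
    length uncovered * suc D
      ≤⟨ length*≤sum-map (λ u → deg F u ≤? D) (deg F) (suc D) uncovered ≰⇒> ⟩
    sum (map (deg F) uncovered) + length lowDegrees * suc D
      ≤⟨ +-monoˡ-≤ _ (sum-map-mono uncovered (λ {u} u∈ → link-conflicts-bound ys u (proj₂ (uncovered⁻ u∈)) (link-colours-proper U proper u) none)) ⟩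
    sum (map (λ u → sum (map (deg (link u F)) W) + s) uncovered) + length lowDegrees * suc D
      ≡⟨ cong (_+ length lowDegrees * suc D) (trans (sum-map-+ _ (λ _ → s) uncovered) (cong (sum (map (λ u → sum (map (deg (link u F)) W)) uncovered) +_) (sum-map-const s uncovered))) ⟩
    sum (map (λ u → sum (map (deg (link u F)) W)) uncovered) + length uncovered * s + length lowDegrees * suc D
      ≤⟨ +-monoˡ-≤ _ (+-monoˡ-≤ _ sum-codeg) ⟩
    (2 + k) * (s * (3 + k) * t + s * d) + length uncovered * s + length lowDegrees * suc D ∎)

-- Unlike in `uniformRainbow`, a deleted vertex also leaves `A`. The Ore bound depends on the size
-- of `A`, and by `oreGap-suc` it drops by exactly `c`, the most that the deletion can take from any
-- other degree.
oreRainbow : ∀ k s {n} (A : Subset n) (F : Fin s → Family n) → (∀ i → Uniform A (3 + k) (F i)) →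
  (∀ i → ProperlyColoured (F i)) → (∀ i → OreCondition A (3 + k) (oreGap ∣ A ∣ (2 + k) s) (F i)) →
  3 * ((3 + k) * (3 + k)) * s < ∣ A ∣ → Rainbow F
oreRainbow k zero    A F U proper ore large = (λ ()) , (λ ()) , λ ()
oreRainbow k (suc s) {n} A F U proper ore large
  -- Writing the size of `A` as `2 + m` makes `c = m C suc k` the maximal possible codegree.
  with m≤n⇒∃[o]m+o≡n (≤-trans {2} (s≤s (*-mono-≤ {1} {3 * ((3 + k) * (3 + k))} (s≤s z≤n) (s≤s (z≤n {s})))) large)
... | m , ∣A∣′ = go
  where
  open ≤-Reasoning
  ∣A∣ = sym ∣A∣′
  c = m C suc k
  t = s * (2 * c + 1)
  d = s * (suc k * c)
  D = oreGap (∣ A ∣) (2 + k) (suc s)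
  large₂ : 3 * ((3 + k) * (3 + k)) * suc s < 2 + m
  large₂ = subst (3 * ((3 + k) * (3 + k)) * suc s <_) ∣A∣ large

  linkLarge : 3 * ((2 + k) * (2 + k)) * suc s ≤ suc m
  linkLarge = s≤s⁻¹ (≤-trans (s≤s (*-monoˡ-≤ (suc s) (*-monoʳ-≤ 3 (*-mono-≤ (n≤1+n (2 + k)) (n≤1+n (2 + k)))))) large₂)

  ∣A∣≤c+2+k : ∣ A ∣ ≤ c + (2 + k)
  ∣A∣≤c+2+k = ≤-trans (≤-reflexive ∣A∣) (≤-trans (s≤s (n<C+k {m} {k} k<m)) (≤-reflexive (sym (+-suc c (suc k)))))
    where
    k<m : suc k ≤ m
    k<m = s≤s⁻¹ (s≤s⁻¹ (begin
      3 + k                                 ≤⟨ m≤m*n (3 + k) (3 + k) ⟩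
      (3 + k) * (3 + k)                     ≤⟨ m≤n*m _ 3 ⟩
      3 * ((3 + k) * (3 + k))               ≤⟨ m≤m*n _ (suc s) ⟩
      3 * ((3 + k) * (3 + k)) * suc s       ≤⟨ <⇒≤ large₂ ⟩
      2 + m                                 ∎))

  uniq : ∀ i v → Unique (colours (link v (F i)))
  uniq i = link-colours-proper (U i) (proper i)

  extendHeavier : ∀ i v → s * ((3 + k) * c + 1) < deg (F i) v → Rainbow F
  extendHeavier i v heavier = Rainbow-extend F i v (λ j → size (U j)) (codeg≤C ∣A∣ (U i) v) (uniq i v) heavier
    (oreRainbow k s (A - v) F′ U′ (λ j → ProperlyColoured-⊆ (proj₁ ∘ ∈-avoiding⁻ (v ∷ []) {F (punchIn i j)}) (proper (punchIn i j)))
      ore′ (subst (3 * ((3 + k) * (3 + k)) * s <_) (sym ∣A-v∣) large′))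
    where
    F′ : Fin s → Family n
    F′ j = avoiding (v ∷ []) (F (punchIn i j))
    v∈A : v ∈ˢ A
    v∈A with 0<deg⇒∈ {F = F i} v (≤-trans (s≤s z≤n) heavier)
    ... | (e , _) , ec∈ , v∈e = within (U i) ec∈ v∈e
    ∣A-v∣ : ∣ A - v ∣ ≡ suc m
    ∣A-v∣ = suc-injective (trans (suc∣p-x∣≡∣p∣ v∈A) ∣A∣)
    U′ : ∀ j → Uniform (A - v) (3 + k) (F′ j)
    U′ j = record
      { distinct = distinct (Uniform-filter _ (U (punchIn i j)))
      ; within   = λ x∈ y∈e → x∈p∧x≢y⇒x∈p-y (within (Uniform-filter _ (U (punchIn i j))) x∈ y∈e)
          (λ { refl → proj₂ (∈-avoiding⁻ (v ∷ []) {F (punchIn i j)} x∈) (here refl) y∈e })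
      ; size     = size (Uniform-filter _ (U (punchIn i j)))
      }
    gap≡ : Fin s → oreGap (∣ A ∣) (2 + k) (suc s) ≡ c + oreGap (∣ A - v ∣) (2 + k) s
    gap≡ j = trans (cong (λ N → oreGap N (2 + k) (suc s)) ∣A∣)
      (trans (oreGap-suc m (suc k) j) (cong (λ N → c + oreGap N (2 + k) s) (sym ∣A-v∣)))
    ore′ : ∀ j → OreCondition (A - v) (3 + k) (oreGap ∣ A - v ∣ (2 + k) s) (F′ j)
    ore′ j = Ore-avoiding v (λ u → codeg≤C ∣A∣ (U (punchIn i j)) u v)
      (subst (λ b → OreCondition A (3 + k) b (F (punchIn i j))) (gap≡ j) (ore (punchIn i j)))
    large′ : 3 * ((3 + k) * (3 + k)) * s < suc m
    large′ = s≤s⁻¹ (≤-trans (s≤s (≤-trans (+-monoˡ-≤ (ρ * s) {1} {ρ} (s≤s z≤n)) (≤-reflexive (sym (*-suc ρ s))))) large₂)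
      where ρ = 3 * ((3 + k) * (3 + k))

  extendFew : ∀ i → length (heavy (F i) t) ≤ s → (∀ v → deg (F i) v ≤ t + d) → Rainbow F
  extendFew i few deg≤
    with R@(ys , ys∈ , _) ← oreRainbow k s A (removeAt F i) (U ∘ punchIn i) (proper ∘ punchIn i)
           (λ j → OreCondition-anti {b = oreGap (∣ A ∣) (2 + k) s} {D} (oreGap-mono (∣ A ∣) (2 + k) s) (ore (punchIn i j)))
           (≤-<-trans (*-monoʳ-≤ (3 * ((3 + k) * (3 + k))) (n≤1+n s)) large)
    with compatibleEdge? (F i) ys
  ... | yes (x , x∈ , compat) = Rainbow-insert F i R x∈ compat
  ... | no none
    with sizes ← (λ j → size (U (punchIn i j)) (ys∈ j))
    with uncovered-count k ys t d D (U i) (proper i) (ore i) none sizes deg≤ few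
  ... | l , l≤ , total = contradiction total (oreCount k s {D = D} {c} large
    (∣A∣≤uncovered k ys t d D (U i) (proper i) (ore i) none sizes deg≤ few)
    (uncovered≤∣A∣ k ys t d D (U i) (proper i) (ore i) none sizes deg≤ few)
    l≤ ∣A∣≤c+2+k
    (subst (λ N → 3 * (3 + k) * (s * c) ≤ 3 * (3 + k) * oreGap N (2 + k) (suc s) + s * c) (sym ∣A∣) (oreGap-lower k s m large₂)))

  go : Rainbow F
  go with any? (λ i → any? (λ v → s * ((3 + k) * c + 1) <? deg (F i) v)) | any? (λ i → length (heavy (F i) t) ≤? s)
  ... | yes (i , v , heavier) | _             = extendHeavier i v heavier
  ... | no noHeavier          | yes (i , few) = extendFew i few
    (λ v → ≤-trans (≮⇒≥ (λ heavier → noHeavier (i , v , heavier))) (≤-reflexive (heavy-threshold (suc k) s c)))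
  -- The links have edges of size `2 + k` on `suc m` vertices, and `linkLarge` is the size condition
  -- for them.
  ... | no _                  | no notFew     = rainbowFromHeavy (uniformRainbow (suc k) (suc s) m) (λ _ → A) F (λ _ → ∣A∣) U uniq linkLarge
    (λ i → ≰⇒> (λ few → notFew (i , few)))

-- From hypergraphs to families

∈-allSubsets : (p : Subset n) → p ∈ allSubsets n
∈-allSubsets []          = here refl
∈-allSubsets (true ∷ p)  = ∈-++⁺ˡ (∈-map⁺ _ (∈-allSubsets p))
∈-allSubsets (false ∷ p) = ∈-++⁺ʳ _ (∈-map⁺ _ (∈-allSubsets p))

allSubsets-unique : ∀ n → Unique (allSubsets n)
allSubsets-unique zero    = [] ∷ []
allSubsets-unique (suc n) = Unique.++⁺ (Unique.map⁺ (λ { refl → refl }) (allSubsets-unique n))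
  (Unique.map⁺ (λ { refl → refl }) (allSubsets-unique n)) disjoint
  where
  disjoint : ∀ {p} → ¬ (p ∈ map (inside ∷_) (allSubsets n) × p ∈ map (outside ∷_) (allSubsets n))
  disjoint (p∈ , q∈) with ∈-map⁻ (inside ∷_) p∈ | ∈-map⁻ (outside ∷_) q∈
  ... | _ , _ , refl | _ , _ , ()

T-does⁻ : {A : Set} (a? : Dec A) → T (does a?) → A
T-does⁻ (yes a) _ = a

T-does⁺ : {A : Set} (a? : Dec A) → A → T (does a?)
T-does⁺ (yes _) _ = tt
T-does⁺ (no ¬a) a = ¬a a

module _ {r : ℕ} (H : Hypergraph n r) (c : Subset n → ℕ) where

  colouredEdges : Family n
  colouredEdges = map (λ e → e , c e) (filter (λ e → T? (isEdge H e)) (allSubsets n))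

  ∈-colouredEdges⁻ : ∀ {x} → x ∈ colouredEdges → Edge H (proj₁ x) × proj₂ x ≡ c (proj₁ x)
  ∈-colouredEdges⁻ x∈ with ∈-map⁻ (λ e → e , c e) x∈
  ... | e , e∈ , refl = proj₂ (∈-filter⁻ (λ e → T? (isEdge H e)) {xs = allSubsets n} e∈) , refl

  ∈-edges⁺ : ∀ {e} → Edge H e → e ∈ edges colouredEdges
  ∈-edges⁺ edge = ∈-map⁺ proj₁ (∈-map⁺ (λ e → e , c e) (∈-filter⁺ (λ e → T? (isEdge H e)) (∈-allSubsets _) edge))

  colouredEdges-uniform : Uniform ⊤ r colouredEdges
  colouredEdges-uniform = record
    { distinct = subst Unique (map-∘ (filter (λ e → T? (isEdge H e)) (allSubsets n)))
        (Unique.map⁺ id (Unique.filter⁺ (λ e → T? (isEdge H e)) (allSubsets-unique n)))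
    ; within   = λ _ _ → ∈⊤
    ; size     = λ x∈ → uniform H _ (proj₁ (∈-colouredEdges⁻ x∈))
    }

  colouredEdges-proper : ProperColoring H c → ProperlyColoured colouredEdges
  colouredEdges-proper proper {e , _} {f , _} x∈ y∈ v∈e v∈f same
    with e∈ , refl ← ∈-colouredEdges⁻ x∈ | f∈ , refl ← ∈-colouredEdges⁻ y∈
    = decidable-stable (e ≟ˢ f) (λ e≢f → proper e f e∈ f∈ e≢f (λ disj → disj (_ , x∈p∩q⁺ (v∈e , v∈f))) same)

  -- The Ore condition bounds degree sums from below, so this inequality carries it over to
  -- `colouredEdges`.
  degree≤deg : ∀ v → degree H v ≤ deg colouredEdges v
  degree≤deg v = begin
    degree H v
      ≤⟨ length-filter-mono _ _ (λ {e} → split e) (allSubsets n) ⟩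
    length (filter (λ e → (v ∈? e) ×-dec T? (isEdge H e)) (allSubsets n))
      ≡⟨ length-filter-filter (v ∈?_) (λ e → T? (isEdge H e)) (allSubsets n) ⟨
    length (filter (v ∈?_) (filter (λ e → T? (isEdge H e)) (allSubsets n)))
      ≡⟨ length-filter-map (λ x → v ∈? proj₁ x) (λ e → e , c e) (filter (λ e → T? (isEdge H e)) (allSubsets n)) ⟨
    deg colouredEdges v ∎
    where
    open ≤-Reasoning
    split : ∀ e → T (isEdge H e ∧ does (v ∈? e)) → v ∈ˢ e × T (isEdge H e)
    split e t with Equivalence.to (T-∧ {isEdge H e}) t
    ... | edge , v∈ = T-does⁻ (v ∈? e) v∈ , edge

  colouredEdges-Ore : (b : ℕ) → OreDegreeGreaterThan H (r * b) → OreCondition ⊤ r b colouredEdges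
  colouredEdges-Ore b ore S _ ∣S∣ S∉ = begin-strict
    r * b                                        <⟨ ore S ∣S∣ (S∉ ∘ ∈-edges⁺) ⟩
    degSet H S                                   ≡⟨ cong (sum ∘ map (degree H)) (filter-≐ _ _ (T-does⁻ (_ ∈? S) , T-does⁺ (_ ∈? S)) (allFin n)) ⟩
    sum (map (degree H) (elements S))            ≤⟨ sum-map-mono (elements S) (λ {v} _ → degree≤deg v) ⟩
    sum (map (deg colouredEdges) (elements S))   ∎
    where open ≤-Reasoning

Rainbow⇒RainbowMatching : {r : ℕ} (H : Fin s → Hypergraph n r) (c : Fin s → Subset n → ℕ) →
  Rainbow (λ i → colouredEdges (H i) (c i)) → RainbowMatching H c
Rainbow⇒RainbowMatching H c (x , x∈ , compat) =
    (λ i → proj₁ (x i))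
  , (λ i → proj₁ (edge i))
  , (λ i j i≢j → proj₁ (compat i j i≢j))
  , λ i j i≢j same → proj₂ (compat i j i≢j) (trans (proj₂ (edge i)) (trans same (sym (proj₂ (edge j)))))
  where
  edge : ∀ i → Edge (H i) (proj₁ (x i)) × proj₂ (x i) ≡ c i (proj₁ (x i))
  edge i = ∈-colouredEdges⁻ (H i) (c i) (x∈ i)

theorem1p8 : ∀ (r s n : ℕ) → 3 ≤ r → 1 ≤ s → 3 * (r * r) * s < n →
    (H : Fin s → Hypergraph n r) → (c : Fin s → Subset n → ℕ) →
    (∀ i → ProperColoring (H i) (c i)) →
    (∀ i → OreDegreeGreaterThan (H i) (oreBound n r s)) →
    RainbowMatching H c
theorem1p8 r s n 3≤r _ large H c proper ore with m≤n⇒∃[o]m+o≡n 3≤r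
-- With `r = 3 + k`, `oreBound n r s` unfolds to `r * oreGap n (2 + k) s`, and the induction starts
-- from the full vertex set.
... | k , refl = Rainbow⇒RainbowMatching H c (oreRainbow k s ⊤ (λ i → colouredEdges (H i) (c i))
  (λ i → colouredEdges-uniform (H i) (c i))
  (λ i → colouredEdges-proper (H i) (c i) (proper i))
  (λ i → subst (λ N → OreCondition ⊤ (3 + k) (oreGap N (2 + k) s) (colouredEdges (H i) (c i))) (sym (∣⊤∣≡n n))
    (colouredEdges-Ore (H i) (c i) (oreGap n (2 + k) s) (ore i)))
  (≤-trans large (≤-reflexive (sym (∣⊤∣≡n n)))))
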